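{- Let $K$ be a field of characteristic different from $2$, let $\mathcal C$ be the conic section and $\ell$ the linear rational map with coefficients $A,B,C,D,E,F\in K$ and $a,b,c,d,e,f\in K$ described in the context, with associated $\mathrm{Disc}(t)$ and $x_1(t),x_2(t),x_0(t)$. Assume that there exists $t_0\in K$ such that $\sqrt{\mathrm{Disc}(t_0)}\in K$, and define the quantity $$k=\frac{\mathrm{Disc}'(t_0)^2-2\,\mathrm{Disc}(t_0)\,\mathrm{Disc}''(t_0)}{\mathrm{Disc}'(t_0)^2}\in K$$ (so $\mathrm{Disc}'(t_0)\neq0$). (1) For every $n\ge 2$ there exist nontrivial (that is, non-constant) sequences $\{t_1,t_2,\dots,t_n\}\subseteq K$ such that each $\sqrt{\mathrm{Disc}(t_i)}\in K$. In particular, each $K$-rational point $P_i=\bigl(x_1(t_i):x_2(t_i):x_0(t_i)\bigr)$ is in $\mathcal C(K)$, and $\ell(P_{i+1})-\ell(P_i)=t_{i+1}-t_i$. (2) There exists an arithmetic progression $\{P_1,P_2,P_3\}\subseteq\mathbb P^2(K)$ on $\mathcal C$ with respect to $\ell$. Moreover, the points of such a progression (with $\ell(P_2)=t_0$) must necessarily be of the form $P_i=\bigl(x_1(t_i):x_2(t_i):x_0(t_i)\bigr)$ in terms of $$t_1=t_0-\delta,\qquad t_2=t_0,\qquad t_3=t_0+\delta,$$ where $$\delta=-\frac{\mathrm{Disc}(t_0)}{\mathrm{Disc}'(t_0)}\cdot\frac{4XY}{Y^2+2XY+kX^2}$$ for some $K$-rational point $(X:Y:1)$ on the cubic curve $$\mathcal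 E_k:\quad Y^2+4XY+4kY=X^3+kX^2 .$$
   Context: The conic section is $$\mathcal C=\{(x_1:x_2:x_0)\in\mathbb P^2 : A x_1^2+2B x_1x_2+C x_2^2+2D x_1x_0+2E x_2x_0+F x_0^2=0\},$$ and the linear rational map $\ell:\mathcal C(K)\to\mathbb P^1(K)$ is $$\ell(x_1:x_2:x_0)=\frac{a x_1+b x_2+c x_0}{d x_1+e x_2+f x_0}.$$ A set $\{P_1,\dots,P_n\}\subseteq\mathbb P^2(K)$ is an arithmetic progression on $\mathcal C$ with respect to $\ell$ if each $P_i\in\mathcal C(K)$ and there is a common difference $\delta=\ell(P_{i+1})-\ell(P_i)$ (the same for all $i$). The discriminant is the polynomial in $t$ (of degree at most 2) $$\mathrm{Disc}(t)=\begin{bmatrix}a-dt\\ b-et\\ c-ft\end{bmatrix}^T\begin{bmatrix}E^2-CF & BF-DE & CD-BE\\ BF-DE & D^2-AF & AE-BD\\ CD-BE & AE-BD & B^2-AC\end{bmatrix}\begin{bmatrix}a-dt\\ b-et\\ c-ft\end{bmatrix},$$ with $\mathrm{Disc}'$, $\mathrm{Disc}''$ its first and second derivatives in $t$. The condition $\sqrt{\mathrm{Disc}(t)}\in K$ means that $\mathrm{Disc}(t)$ is a square in $K$. The coordinates are $$x_1(t)=B(b-et)(c-ft)-C(a-dt)(c-ft)-D(b-et)^2+E(a-dt)(b-et)\pm(b-et)\sqrt{\mathrm{Disc}(t)},$$ $$x_2(t)=-A(b-et)(c-ft)+B(a-dt)(c-ft)+D(a-dt)(b-et)-E(a-dt)^2\mp(a-dt)\sqrt{\mathrm{Disc}(t)},$$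 $$x_0(t)=A(b-et)^2-2B(a-dt)(b-et)+C(a-dt)^2,$$ where the upper signs are taken together or the lower signs are taken together.
   Formalization: Excluded as false or undefined: coordinates (0:0:0) or ℓ=0/0 in (1); in (2) points the formula cannot give when x₀(t)=0, and the δ-formula if Disc(t₀)=0≠δ, or if k=0 and δ=0 or Disc(t₀±δ)=0. Equality in K is assumed decidable; progressions may have δ=0. -}

module Defs where

open import Algebra.Apartness.Bundles using (HeytingField)
import Algebra.Apartness.Properties.HeytingCommutativeRing as HeytingProperties
open import Data.Fin.Base using (Fin; zero; suc; toℕ)
open import Data.List.Base using (List; []; _∷_; [_]; map)
open import Data.Nat.Base using (ℕ) renaming (suc to 1+_)
open import Data.Product.Base using (Σ; Σ-syntax; ∃-syntax; _×_; proj₁)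
open import Data.Sum.Base using (_⊎_)
import Data.Vec.Base as Vec
open Vec using (Vec; []; _∷_)
open import Level using (_⊔_)
open import Relation.Binary.PropositionalEquality.Core using (_≡_)

module OverField {p ℓ₁ ℓ₂} (K : HeytingField p ℓ₁ ℓ₂) where

  open HeytingField K public hiding (zero)
  open HeytingProperties heytingCommutativeRing public using (x#0y#0→xy#0)

  infixl 7 _/_⟨_⟩
  _/_⟨_⟩ : (x y : Carrier) → y # 0# → Carrier
  x / y ⟨ y#0 ⟩ = x * proj₁ (#⇒invertible y#0)

  2# 4# : Carrier
  2# = 1# + 1#
  4# = 2# + 2#

  infix 8 _²
  _² : Carrier → Carrier
  x ² = x * x

  IsSquare : Carrier → Set (p ⊔ ℓ₁)
  IsSquare x = ∃[ s ] s ² ≈ x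

  NonConstant : ∀ {n} → (Fin n → Carrier) → Set ℓ₂
  NonConstant t = ∃[ i ] ∃[ j ] t i # t j

  -- Univariate polynomials as coefficient lists, constant term first.

  Poly : Set p
  Poly = List Carrier

  infixl 6 _⊕_
  infixl 7 _⊗_

  _⊕_ : Poly → Poly → Poly
  []      ⊕ g       = g
  (x ∷ f) ⊕ []      = x ∷ f
  (x ∷ f) ⊕ (y ∷ g) = (x + y) ∷ (f ⊕ g)

  _⊗_ : Poly → Poly → Poly
  []      ⊗ g = []
  (x ∷ f) ⊗ g = map (x *_) g ⊕ (0# ∷ (f ⊗ g))

  eval : Poly → Carrier → Carrier
  eval []      t = 0#
  eval (x ∷ f) t = x + t * eval f t

  -- (x + T f)′ = f + T f′
  derivative : Poly → Poly
  derivative []      = []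
  derivative (x ∷ f) = f ⊕ (0# ∷ derivative f)

  dot : ∀ {n} → Vec Poly n → Vec Poly n → Poly
  dot v w = Vec.foldr′ _⊕_ [] (Vec.zipWith _⊗_ v w)

  record Coordinates : Set p where
    constructor ⟨_,_,_⟩
    field x₁ x₂ x₀ : Carrier

  open Coordinates public

  NonZero : Coordinates → Set ℓ₂
  NonZero v = x₁ v # 0# ⊎ x₂ v # 0# ⊎ x₀ v # 0#

  -- Homogeneous coordinates representing the same point of ℙ².
  infix 4 _∼_
  _∼_ : Coordinates → Coordinates → Set (p ⊔ ℓ₁ ⊔ ℓ₂)
  v ∼ w = Σ[ μ ∈ Carrier ] μ # 0#
    × x₁ v ≈ μ * x₁ w × x₂ v ≈ μ * x₂ w × x₀ v ≈ μ * x₀ w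

  record ℙ² : Set (p ⊔ ℓ₂) where
    constructor point
    field
      coordinates : Coordinates
      nonZero     : NonZero coordinates

  open ℙ² public

  record Conic : Set p where
    field A B C D E F : Carrier

  record LinearMap : Set p where
    field a b c d e f : Carrier

  OnCubic : (k X Y : Carrier) → Set ℓ₁
  OnCubic k X Y = Y ² + 4# * X * Y + 4# * k * Y ≈ X * X ² + k * X ²

  module ConicWithMap (𝒞 : Conic) (ℒ : LinearMap) where

    open Conic 𝒞
    open LinearMap ℒ

    OnConic : ℙ² → Set ℓ₁
    OnConic (point ⟨ X₁ , X₂ , X₀ ⟩ _) =
      A * X₁ ² + 2# * B * X₁ * X₂ + C * X₂ ²
        + 2# * D * X₁ * X₀ + 2# * E * X₂ * X₀ + F * X₀ ² ≈ 0#

    numerator denominator : ℙ² → Carrier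
    numerator   (point ⟨ X₁ , X₂ , X₀ ⟩ _) = a * X₁ + b * X₂ + c * X₀
    denominator (point ⟨ X₁ , X₂ , X₀ ⟩ _) = d * X₁ + e * X₂ + f * X₀

    -- (numerator : denominator) is a point of ℙ¹ …
    Defined : ℙ² → Set ℓ₂
    Defined P = numerator P # 0# ⊎ denominator P # 0#

    -- … other than the point at infinity.
    Finite : ℙ² → Set ℓ₂
    Finite P = denominator P # 0#

    ℓ : (P : ℙ²) → Finite P → Carrier
    ℓ P fin = numerator P / denominator P ⟨ fin ⟩

    -- Consecutive differences only make sense for finite values of ℓ.
    record IsProgression {n : ℕ} (P : Fin n → ℙ²) (δ : Carrier) : Set (ℓ₁ ⊔ ℓ₂) where
      field
        onConic : ∀ i → OnConic (P i)
        finite  : ∀ i → Finite (P i)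
        step    : ∀ i j → toℕ j ≡ 1+ toℕ i →
                  ℓ (P j) (finite j) - ℓ (P i) (finite i) ≈ δ

    IsArithmeticProgression : ∀ {n} → (Fin n → ℙ²) → Set (p ⊔ ℓ₁ ⊔ ℓ₂)
    IsArithmeticProgression P = ∃[ δ ] IsProgression P δ

    discMatrix : Vec (Vec Carrier 3) 3
    discMatrix =
        (E ² - C * F   ∷ B * F - D * E ∷ C * D - B * E ∷ [])
      ∷ (B * F - D * E ∷ D ² - A * F   ∷ A * E - B * D ∷ [])
      ∷ (C * D - B * E ∷ A * E - B * D ∷ B ² - A * C   ∷ [])
      ∷ []

    pencil : Vec Poly 3
    pencil = (a ∷ - d ∷ []) ∷ (b ∷ - e ∷ []) ∷ (c ∷ - f ∷ []) ∷ []

    discriminant : Poly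
    discriminant = dot pencil (Vec.map (λ row → dot (Vec.map [_] row) pencil) discMatrix)

    Disc Disc′ Disc″ : Carrier → Carrier
    Disc  = eval discriminant
    Disc′ = eval (derivative discriminant)
    Disc″ = eval (derivative (derivative discriminant))

    -- s is a square root of Disc t; the upper signs are those of s and the
    -- lower signs those of - s.
    coords : (t s : Carrier) → Coordinates
    coords t s = ⟨ B * q * r - C * p′ * r - D * q ² + E * p′ * q + q * s
                 , - (A * q * r) + B * p′ * r + D * p′ * q - E * p′ ² - p′ * s
                 , A * q ² - 2# * B * p′ * q + C * p′ ² ⟩
      where
      p′ = a - d * t
      q  = b - e * t
      r  = c - f * t

    HasForm : ℙ² → Carrier → Set (p ⊔ ℓ₁ ⊔ ℓ₂)
    HasForm P t = ∃[ s ] s ² ≈ Disc t × coordinates P ∼ coords t s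

    -- The third coordinate x₀(t) does not depend on the signs.  When it
    -- vanishes, coords t s is (0 , 0 , 0) for at least one root s, and for the
    -- other root it is zero or a point at infinity.  So, if P lies on the conic
    -- and ℓ(P) = t, then P can have the form (x₁(t) : x₂(t) : x₀(t)) only in
    -- the following two cases.
    Determined : ℙ² → Carrier → Set (p ⊔ ℓ₁ ⊔ ℓ₂)
    Determined P t =
        x₀ (coords t 0#) # 0#
      ⊎ x₀ (coordinates P) ≈ 0# × (∃[ s ] s ² ≈ Disc t × NonZero (coords t s))

    invariant : ∀ t₀ → Disc′ t₀ # 0# → Carrier
    invariant t₀ h =
      (Disc′ t₀ ² - 2# * Disc t₀ * Disc″ t₀) / Disc′ t₀ ² ⟨ x#0y#0→xy#0 h h ⟩

    -- δ = - Disc t₀ / Disc′ t₀ · 4XY / (Y² + 2XY + kX²) for some affine point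
    -- (X , Y) of the cubic, where k is the invariant.
    FromCubic : ∀ t₀ → Disc′ t₀ # 0# → Carrier → Set (p ⊔ ℓ₁ ⊔ ℓ₂)
    FromCubic t₀ h δ = ∃[ X ] ∃[ Y ] OnCubic k X Y
      × Σ[ den#0 ∈ Y ² + 2# * X * Y + k * X ² # 0# ]
          δ ≈ - (Disc t₀ / Disc′ t₀ ⟨ h ⟩)
              * (4# * X * Y / (Y ² + 2# * X * Y + k * X ²) ⟨ den#0 ⟩)
      where k = invariant t₀ h

    -- The differences δ, with Disc (t₀ - δ) and Disc (t₀ + δ) both squares, that
    -- FromCubic misses.  If Disc t₀ = 0, then FromCubic yields only δ = 0.  If
    -- k = 0, then the δ listed correspond on the nodal cubic Y² + 4XY = X³ only
    -- to the node (0 , 0), where the fraction is 0/0, or to the point at infinity.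
    Exceptional : ∀ t₀ → Disc′ t₀ # 0# → Carrier → Set (ℓ₁ ⊔ ℓ₂)
    Exceptional t₀ h δ =
        Disc t₀ ≈ 0# × δ # 0#
      ⊎ invariant t₀ h ≈ 0#
        × (δ ≈ 0# ⊎ Disc (t₀ - δ) ≈ 0# ⊎ Disc (t₀ + δ) ≈ 0#)

    threeTerms : (t₀ δ : Carrier) → Fin 3 → Carrier
    threeTerms t₀ δ = Vec.lookup (t₀ - δ ∷ t₀ ∷ t₀ + δ ∷ [])

{-# OPTIONS --safe #-}
module Submission where

-- Let S be the matrix of the conic and L(t) the line of points with ℓ = t.  The
-- map T v = L(t) × S v preserves the plane L(t) · v = 0, and T² = Disc(t) there;
-- a vector of this plane is on the conic exactly if it is an eigenvector of T.
-- Hence rational points on L(t) yield square roots s of Disc(t), and conversely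
-- the coordinates of the paper are (s − T)(L(t) × e₃), an eigenvector for − s.
-- Disc′(t₀) ≠ 0 makes the conic smooth at its points on L(t₀), so lines through
-- such a point reach a point at which ℓ is finite.
--
-- For the cubic, normalise τ = δ Disc′(t₀) / Disc(t₀).  That Disc(t₀ ± δ) are
-- squares becomes (2 ± τ)² − k τ² = y², z².  The first equation parametrises τ
-- by m = − (2 + τ + y) / τ, and the second one then says that the quadratic
-- equation for X that results from Y = m X on the cubic has a square discriminant.

open import Defs
open import Algebra.Apartness.Bundles using (HeytingField; HeytingCommutativeRing)
import Algebra.Apartness.Properties.HeytingCommutativeRing as HeytingProperties
open import Algebra.Bundles using (CommutativeRing; RawRing)
import Algebra.Properties.Ring as RingProperties
open import Data.Bool.Base using (T)
open import Data.Fin using (#_)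
open import Data.Fin.Base using (Fin; zero; suc; toℕ)
open import Data.List.Base using ([]; _∷_; map)
open import Data.Maybe.Base using (Maybe; just; nothing; is-just)
open import Data.Nat.Base as ℕ using (ℕ; _≤_; s≤s)
import Data.Nat.Properties as ℕ
open import Data.Product.Base using (Σ-syntax; ∃-syntax; _×_; _,_; proj₁; proj₂)
open import Data.Sum.Base using (_⊎_; inj₁; inj₂; [_,_]′)
open import Data.Vec.Base as Vec using (Vec; []; _∷_; allFin)
open import Data.Vec.N-ary using (N-ary; _$ⁿ_)
open import Relation.Binary.Definitions using (Decidable)
open import Relation.Binary.PropositionalEquality.Core as ≡ using (_≡_)
import Relation.Binary.Reasoning.Setoid as SetoidReasoning
open import Relation.Nullary.Decidable.Core using (yes; no)
open import Relation.Nullary.Negation.Core using (¬_; contradiction)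

-- A ring solver with integer coefficients

module RingSolver {c ℓ} (R : CommutativeRing c ℓ) where

  open CommutativeRing R
  open import Algebra.Properties.Ring ring
  open import Algebra.Properties.Semiring.Mult semiring renaming (_×_ to _ו_)
  open import Algebra.Properties.CommutativeSemigroup +-commutativeSemigroup using (interchange)
  open import Algebra.Solver.Ring.AlmostCommutativeRing
  open import Relation.Binary.Reasoning.Setoid setoid

  -- (m , n) stands for the integer m − n, so no case analysis on signs is needed.
  Coefficients : RawRing _ _
  Coefficients = record
    { Carrier = ℕ × ℕ
    ; _≈_ = _≡_
    ; _+_ = λ (m , n) (m′ , n′) → m ℕ.+ m′ , n ℕ.+ n′
    ; _*_ = λ (m , n) (m′ , n′) → m ℕ.* m′ ℕ.+ n ℕ.* n′ , m ℕ.* n′ ℕ.+ n ℕ.* m′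
    ; -_ = λ (m , n) → n , m
    ; 0# = 0 , 0
    ; 1# = 1 , 0
    }

  open RawRing Coefficients using () renaming (_+_ to _+ᶜ_; _*_ to _*ᶜ_; -_ to -ᶜ_)

  private
    ι : ℕ → Carrier
    ι n = n ו 1#

    -- The separate clauses make the literals 0# and 1# definitionally equal to
    -- the values of the corresponding constants.
    ⟦_⟧ᶜ : ℕ × ℕ → Carrier
    ⟦ 0 , 0 ⟧ᶜ = 0#
    ⟦ 1 , 0 ⟧ᶜ = 1#
    ⟦ m , n ⟧ᶜ = ι m - ι n

    -- The clauses for literals depart from the shape of a difference; the homomorphism laws go
    -- through this uniform description.
    ⟦_⟧ᶜ-difference : ∀ p → ⟦ p ⟧ᶜ ≈ ι (proj₁ p) - ι (proj₂ p)
    ⟦ 0 , 0 ⟧ᶜ-difference = sym (-‿inverseʳ 0#)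
    ⟦ 1 , 0 ⟧ᶜ-difference = sym (trans (+-cong (+-identityʳ 1#) -0#≈0#) (+-identityʳ 1#))
    ⟦ 0 , ℕ.suc _ ⟧ᶜ-difference = refl
    ⟦ 1 , ℕ.suc _ ⟧ᶜ-difference = refl
    ⟦ ℕ.suc (ℕ.suc _) , _ ⟧ᶜ-difference = refl

    -‿+-comm-- : ∀ x y z w → (x + y) - (z + w) ≈ (x - z) + (y - w)
    -‿+-comm-- x y z w = begin
      (x + y) - (z + w)      ≈⟨ +-congˡ (-‿+-comm z w) ⟨
      (x + y) + (- z + - w)  ≈⟨ interchange x y (- z) (- w) ⟩
      (x - z) + (y - w)      ∎

    -‿-‿* : ∀ x y → - x * - y ≈ x * y
    -‿-‿* x y = begin
      - x * - y      ≈⟨ -‿distribˡ-* x (- y) ⟨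
      - (x * - y)    ≈⟨ -‿cong (-‿distribʳ-* x y) ⟨
      - - (x * y)    ≈⟨ -‿involutive (x * y) ⟩
      x * y          ∎

    ι-bilinear : ∀ m n m′ n′ → ι (m ℕ.* m′ ℕ.+ n ℕ.* n′) ≈ ι m * ι m′ + ι n * ι n′
    ι-bilinear m n m′ n′ =
      trans (×-homo-+ 1# (m ℕ.* m′) (n ℕ.* n′)) (+-cong (×1-homo-* m m′) (×1-homo-* n n′))

    difference-* : ∀ x y z w → (x * z + y * w) - (x * w + y * z) ≈ (x - y) * (z - w)
    difference-* x y z w = begin
      (x * z + y * w) - (x * w + y * z)                ≈⟨ -‿+-comm-- (x * z) (y * w) (x * w) (y * z) ⟩
      (x * z - x * w) + (y * w - y * z)
        ≈⟨ +-cong (+-congˡ (-‿distribʳ-* x w)) (+-comm (y * w) (- (y * z))) ⟩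
      (x * z + x * - w) + (- (y * z) + y * w)
        ≈⟨ +-cong (distribˡ x z (- w)) (+-cong (sym (-‿distribˡ-* y z)) (-‿-‿* y w)) ⟨
      x * (z - w) + (- y * z + - y * - w)              ≈⟨ +-congˡ (distribˡ (- y) z (- w)) ⟨
      x * (z - w) + - y * (z - w)                      ≈⟨ distribʳ (z - w) x (- y) ⟨
      (x - y) * (z - w)                                ∎

    morphism : Coefficients -Raw-AlmostCommutative⟶ fromCommutativeRing R
    morphism = record
      { ⟦_⟧ = ⟦_⟧ᶜ
      ; +-homo = λ p@(m , n) q@(m′ , n′) → begin
          ⟦ p +ᶜ q ⟧ᶜ                      ≈⟨ ⟦ p +ᶜ q ⟧ᶜ-difference ⟩
          ι (m ℕ.+ m′) - ι (n ℕ.+ n′)      ≈⟨ +-cong (×-homo-+ 1# m m′) (-‿cong (×-homo-+ 1# n n′)) ⟩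
          (ι m + ι m′) - (ι n + ι n′)      ≈⟨ -‿+-comm-- (ι m) (ι m′) (ι n) (ι n′) ⟩
          (ι m - ι n) + (ι m′ - ι n′)      ≈⟨ +-cong ⟦ p ⟧ᶜ-difference ⟦ q ⟧ᶜ-difference ⟨
          ⟦ p ⟧ᶜ + ⟦ q ⟧ᶜ                  ∎
      ; *-homo = λ p@(m , n) q@(m′ , n′) → begin
          ⟦ p *ᶜ q ⟧ᶜ                      ≈⟨ ⟦ p *ᶜ q ⟧ᶜ-difference ⟩
          ι (m ℕ.* m′ ℕ.+ n ℕ.* n′) - ι (m ℕ.* n′ ℕ.+ n ℕ.* m′)
            ≈⟨ +-cong (ι-bilinear m n m′ n′) (-‿cong (ι-bilinear m n n′ m′)) ⟩
          (ι m * ι m′ + ι n * ι n′) - (ι m * ι n′ + ι n * ι m′)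
            ≈⟨ difference-* (ι m) (ι n) (ι m′) (ι n′) ⟩
          (ι m - ι n) * (ι m′ - ι n′)      ≈⟨ *-cong ⟦ p ⟧ᶜ-difference ⟦ q ⟧ᶜ-difference ⟨
          ⟦ p ⟧ᶜ * ⟦ q ⟧ᶜ                  ∎
      ; -‿homo = λ p@(m , n) → begin
          ⟦ -ᶜ p ⟧ᶜ        ≈⟨ ⟦ -ᶜ p ⟧ᶜ-difference ⟩
          ι n - ι m        ≈⟨ +-comm (ι n) (- ι m) ⟩
          - ι m + ι n      ≈⟨ +-congˡ (-‿involutive (ι n)) ⟨
          - ι m + - - ι n  ≈⟨ -‿+-comm (ι m) (- ι n) ⟩
          - (ι m - ι n)    ≈⟨ -‿cong ⟦ p ⟧ᶜ-difference ⟨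
          - ⟦ p ⟧ᶜ         ∎
      ; 0-homo = refl
      ; 1-homo = refl
      }

    open _-Raw-AlmostCommutative⟶_ morphism using (+-homo; -‿homo)

    -- Different pairs can stand for the same integer, so `m − n = m′ − n′` is tested as
    -- `m + n′ = n + m′`.
    equal? : ∀ p q → Maybe (⟦ p ⟧ᶜ ≈ ⟦ q ⟧ᶜ)
    equal? p@(m , n) q@(m′ , n′) with m ℕ.+ n′ ℕ.≟ n ℕ.+ m′
    ... | no _ = nothing
    ... | yes e = just (x∙y⁻¹≈ε⇒x≈y _ _ (begin
      ⟦ p ⟧ᶜ - ⟦ q ⟧ᶜ                ≈⟨ +-congˡ (-‿homo q) ⟨
      ⟦ p ⟧ᶜ + ⟦ -ᶜ q ⟧ᶜ             ≈⟨ +-homo p (-ᶜ q) ⟨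
      ⟦ p +ᶜ (-ᶜ q) ⟧ᶜ               ≈⟨ ⟦ p +ᶜ (-ᶜ q) ⟧ᶜ-difference ⟩
      ι (m ℕ.+ n′) - ι (n ℕ.+ m′)    ≈⟨ +-congʳ (×-congˡ e) ⟩
      ι (n ℕ.+ m′) - ι (n ℕ.+ m′)    ≈⟨ -‿inverseʳ _ ⟩
      0#                             ∎))

  open import Algebra.Solver.Ring Coefficients (fromCommutativeRing R) morphism equal? public
    using (Polynomial; con; var; :-_; _:+_; _:-_; _:*_; ⟦_⟧; normalise; _≟N_; correct; ⟦_⟧N-cong)

  -- The normal forms are compared during type checking; if they agree, the implicit argument has
  -- the unit type and is filled in automatically.
  identity : ∀ {n} (e₁ e₂ : Polynomial n) {_ : T (is-just (normalise e₁ ≟N normalise e₂))} →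
             (ρ : Vec Carrier n) → ⟦ e₁ ⟧ ρ ≈ ⟦ e₂ ⟧ ρ
  identity e₁ e₂ ρ with normalise e₁ ≟N normalise e₂
  ... | just e = trans (sym (correct e₁ ρ)) (trans (⟦ e ⟧N-cong ρ) (correct e₂ ρ))

  solve : ∀ n (f : N-ary n (Polynomial n) (Polynomial n × Polynomial n)) →
          let e = f $ⁿ Vec.map var (allFin n) in
          {_ : T (is-just (normalise (proj₁ e) ≟N normalise (proj₂ e)))} →
          (ρ : Vec Carrier n) → ⟦ proj₁ e ⟧ ρ ≈ ⟦ proj₂ e ⟧ ρ
  solve n f {t} = identity (proj₁ e) (proj₂ e) {t}
    where e = f $ⁿ Vec.map var (allFin n)

  :0 :1 :2 :4 : ∀ {n} → Polynomial n
  :0 = con (0 , 0)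
  :1 = con (1 , 0)
  :2 = :1 :+ :1
  :4 = :2 :+ :2

  infix 4 _:=_
  _:=_ : ∀ {n} → Polynomial n → Polynomial n → Polynomial n × Polynomial n
  _:=_ = _,_

  -- c is the multiplier of the hypothesis in the certificate that is handed to solve.
  modulo : ∀ {l r x y} → l ≈ r → ∀ {c} → x ≈ y + c * (l - r) → x ≈ y
  modulo {l} {r} {x} {y} l≈r {c} eq = begin
    x                  ≈⟨ eq ⟩
    y + c * (l - r)    ≈⟨ +-congˡ (*-congˡ (x≈y⇒x∙y⁻¹≈ε l≈r)) ⟩
    y + c * 0#         ≈⟨ +-congˡ (zeroʳ c) ⟩
    y + 0#             ≈⟨ +-identityʳ y ⟩
    y                  ∎

-- Vectors, quadratic forms and the polar map

record Triple {a} (X : Set a) : Set a where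
  constructor ⟨_,_,_⟩
  field x₁ x₂ x₀ : X

record Symmetric {a} (X : Set a) : Set a where
  field A B C D E F : X

-- Over a raw ring the same formulas can be read both in the field and in the syntax of the solver.
module VectorAlgebra {a ℓ} (R : RawRing a ℓ) where

  open RawRing R

  infixl 6 _-_ _⊞_ _⊟_
  infixl 7 _·_ _⨯_ _⊙_

  _-_ : Carrier → Carrier → Carrier
  x - y = x + - y

  _⊞_ _⊟_ _⨯_ : Triple Carrier → Triple Carrier → Triple Carrier
  ⟨ x , y , z ⟩ ⊞ ⟨ x′ , y′ , z′ ⟩ = ⟨ x + x′ , y + y′ , z + z′ ⟩
  ⟨ x , y , z ⟩ ⊟ ⟨ x′ , y′ , z′ ⟩ = ⟨ x - x′ , y - y′ , z - z′ ⟩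
  ⟨ x , y , z ⟩ ⨯ ⟨ x′ , y′ , z′ ⟩ = ⟨ y * z′ - z * y′ , z * x′ - x * z′ , x * y′ - y * x′ ⟩

  _⊙_ : Carrier → Triple Carrier → Triple Carrier
  c ⊙ ⟨ x , y , z ⟩ = ⟨ c * x , c * y , c * z ⟩

  _·_ : Triple Carrier → Triple Carrier → Carrier
  ⟨ x , y , z ⟩ · ⟨ x′ , y′ , z′ ⟩ = x * x′ + y * y′ + z * z′

  𝟎 : Triple Carrier
  𝟎 = ⟨ 0# , 0# , 0# ⟩

  matrix : Symmetric Carrier → Triple Carrier → Triple Carrier
  matrix S ⟨ x , y , z ⟩ = ⟨ A * x + B * y + D * z , B * x + C * y + E * z , D * x + E * y + F * z ⟩
    where open Symmetric S

  -- This is discMatrix.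
  -adjugate : Symmetric Carrier → Symmetric Carrier
  -adjugate S = record
    { A = E * E - C * F ; B = B * F - D * E ; C = D * D - A * F
    ; D = C * D - B * E ; E = A * E - B * D ; F = B * B - A * C }
    where open Symmetric S

  form : Symmetric Carrier → Triple Carrier → Carrier
  form S v = v · matrix S v

  -- On the plane L · v = 0 this endomorphism T satisfies T² = disc S L.
  polar : Symmetric Carrier → Triple Carrier → Triple Carrier → Triple Carrier
  polar S L v = L ⨯ matrix S v

  disc : Symmetric Carrier → Triple Carrier → Carrier
  disc S L = form (-adjugate S) L

  -- (s − T) w, which T multiplies by − s whenever s² = disc S L and L · w = 0.
  eigenvector : Symmetric Carrier → Triple Carrier → Triple Carrier → Carrier → Triple Carrier
  eigenvector S L w s = s ⊙ w ⊟ polar S L w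

-- Polynomial identities between vectors and a symmetric matrix

module Identities {a ℓ} (R : CommutativeRing a ℓ) where

  open CommutativeRing R hiding (_-_)
  open VectorAlgebra rawRing
  open RingSolver R
  open Triple

  infix 4 _≋_
  record _≋_ (v w : Triple Carrier) : Set ℓ where
    constructor ⟨_,_,_⟩
    field
      ≈₁ : x₁ v ≈ x₁ w
      ≈₂ : x₂ v ≈ x₂ w
      ≈₀ : x₀ v ≈ x₀ w

  ≋-sym : ∀ {v w} → v ≋ w → w ≋ v
  ≋-sym ⟨ e₁ , e₂ , e₀ ⟩ = ⟨ sym e₁ , sym e₂ , sym e₀ ⟩

  ≋-trans : ∀ {u v w} → u ≋ v → v ≋ w → u ≋ w
  ≋-trans ⟨ e₁ , e₂ , e₀ ⟩ ⟨ f₁ , f₂ , f₀ ⟩ = ⟨ trans e₁ f₁ , trans e₂ f₂ , trans e₀ f₀ ⟩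

  ·-congˡ : ∀ u {v w} → v ≋ w → u · v ≈ u · w
  ·-congˡ _ ⟨ e₁ , e₂ , e₀ ⟩ = +-cong (+-cong (*-congˡ e₁) (*-congˡ e₂)) (*-congˡ e₀)

  ⊙-cong : ∀ {c d v w} → c ≈ d → v ≋ w → c ⊙ v ≋ d ⊙ w
  ⊙-cong e ⟨ e₁ , e₂ , e₀ ⟩ = ⟨ *-cong e e₁ , *-cong e e₂ , *-cong e e₀ ⟩

  ⊟-cong : ∀ {u v u′ v′} → u ≋ u′ → v ≋ v′ → u ⊟ v ≋ u′ ⊟ v′
  ⊟-cong ⟨ e₁ , e₂ , e₀ ⟩ ⟨ f₁ , f₂ , f₀ ⟩ = ⟨ +-cong e₁ (-‿cong f₁) , +-cong e₂ (-‿cong f₂) , +-cong e₀ (-‿cong f₀) ⟩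

  ⨯-congˡ : ∀ u {v w} → v ≋ w → u ⨯ v ≋ u ⨯ w
  ⨯-congˡ _ ⟨ e₁ , e₂ , e₀ ⟩ = ⟨ minus e₀ e₂ , minus e₁ e₀ , minus e₂ e₁ ⟩
    where
    minus : ∀ {x y z z′ w w′} → z ≈ z′ → w ≈ w′ → x * z - y * w ≈ x * z′ - y * w′
    minus e f = +-cong (*-congˡ e) (-‿cong (*-congˡ f))

  matrix-cong : ∀ S {v w} → v ≋ w → matrix S v ≋ matrix S w
  matrix-cong S v≋w = ⟨ ·-congˡ ⟨ A , B , D ⟩ v≋w , ·-congˡ ⟨ B , C , E ⟩ v≋w , ·-congˡ ⟨ D , E , F ⟩ v≋w ⟩
    where open Symmetric S

  polar-cong : ∀ S L {v w} → v ≋ w → polar S L v ≋ polar S L w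
  polar-cong S L v≋w = ⨯-congˡ L (matrix-cong S v≋w)

  private
    -- One set of 17 variables serves all identities: two scalars, three vectors and six matrix
    -- entries. Those absent from an identity are given zero values.
    expressions : RawRing _ _
    expressions = record
      { Carrier = Polynomial 17 ; _≈_ = _≡_
      ; _+_ = _:+_ ; _*_ = _:*_ ; -_ = :-_ ; 0# = :0 ; 1# = :1 }

    module V = VectorAlgebra expressions

    :S : Symmetric (Polynomial 17)
    :S = record { A = var (# 11) ; B = var (# 12) ; C = var (# 13) ; D = var (# 14) ; E = var (# 15) ; F = var (# 16) }

    :c :d : Polynomial 17
    :c = var (# 0)
    :d = var (# 1)

    :u :v :w : Triple (Polynomial 17)
    :u = ⟨ var (# 2) , var (# 3) , var (# 4) ⟩
    :v = ⟨ var (# 5) , var (# 6) , var (# 7) ⟩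
    :w = ⟨ var (# 8) , var (# 9) , var (# 10) ⟩

    𝟎ˢ : Symmetric Carrier
    𝟎ˢ = record { A = 0# ; B = 0# ; C = 0# ; D = 0# ; E = 0# ; F = 0# }

    record Environment : Set a where
      constructor environment
      field
        S     : Symmetric Carrier
        u v w : Triple Carrier
        c d   : Carrier

    values : Environment → Vec Carrier 17
    values (environment S u v w c d) =
      c ∷ d ∷ x₁ u ∷ x₂ u ∷ x₀ u ∷ x₁ v ∷ x₂ v ∷ x₀ v ∷ x₁ w ∷ x₂ w ∷ x₀ w ∷ A ∷ B ∷ C ∷ D ∷ E ∷ F ∷ []
      where open Symmetric S

    _≟_ : Polynomial 17 → Polynomial 17 → Set
    e₁ ≟ e₂ = T (is-just (normalise e₁ ≟N normalise e₂))

    scalars : (e₁ e₂ : Polynomial 17) {_ : e₁ ≟ e₂} → ∀ ρ → ⟦ e₁ ⟧ (values ρ) ≈ ⟦ e₂ ⟧ (values ρ)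
    scalars e₁ e₂ {t} ρ = identity e₁ e₂ {t} (values ρ)

    vectors : (e₁ e₂ : Triple (Polynomial 17))
              {_ : x₁ e₁ ≟ x₁ e₂} {_ : x₂ e₁ ≟ x₂ e₂} {_ : x₀ e₁ ≟ x₀ e₂} → ∀ ρ →
              let value = λ e → ⟦ e ⟧ (values ρ) in
              ⟨ value (x₁ e₁) , value (x₂ e₁) , value (x₀ e₁) ⟩ ≋ ⟨ value (x₁ e₂) , value (x₂ e₂) , value (x₀ e₂) ⟩
    vectors e₁ e₂ {t₁} {t₂} {t₀} ρ =
      ⟨ scalars (x₁ e₁) (x₁ e₂) {t₁} ρ , scalars (x₂ e₁) (x₂ e₂) {t₂} ρ , scalars (x₀ e₁) (x₀ e₂) {t₀} ρ ⟩

  -- Since Mᵀ = M, M [v] M = [adj(M) v] for the cross product matrix [v].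
  polar-polar : ∀ S u v w → polar S u (polar S v w) ≋
                (u · matrix (-adjugate S) v) ⊙ w ⊟ (u · w) ⊙ matrix (-adjugate S) v
  polar-polar S u v w = vectors
    (V.polar :S :u (V.polar :S :v :w))
    ((:u V.· V.matrix (V.-adjugate :S) :v) V.⊙ :w V.⊟ (:u V.· :w) V.⊙ V.matrix (V.-adjugate :S) :v)
    (environment S u v w 0# 0#)

  polar-homogeneous : ∀ S L c v → polar S L (c ⊙ v) ≋ c ⊙ polar S L v
  polar-homogeneous S L c v = vectors
    (V.polar :S :u (:c V.⊙ :v)) (:c V.⊙ V.polar :S :u :v) (environment S L v 𝟎 c 0#)

  -- Expansion of a double cross product. For `v` on the conic and on the line `L` the right-hand
  -- side vanishes, so `polar S L v` is parallel to `v`.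
  ⨯-polar : ∀ S L v → v ⨯ polar S L v ≋ form S v ⊙ L ⊟ (L · v) ⊙ matrix S v
  ⨯-polar S L v = vectors
    (:v V.⨯ V.polar :S :u :v) (V.form :S :v V.⊙ :u V.⊟ (:u V.· :v) V.⊙ V.matrix :S :v)
    (environment S L v 𝟎 0# 0#)

  -- Cyclic permutation of a scalar triple product.
  form-⨯ : ∀ S L g → form S (L ⨯ g) ≈ - (g · polar S L (L ⨯ g))
  form-⨯ S L g = scalars
    (V.form :S (:u V.⨯ :v)) (:- (:v V.· V.polar :S :u (:u V.⨯ :v))) (environment S L g 𝟎 0# 0#)

  ⨯-⨯ : ∀ u v w → u ⨯ (v ⨯ w) ≋ (u · w) ⊙ v ⊟ (u · v) ⊙ w
  ⨯-⨯ u v w = vectors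
    (:u V.⨯ (:v V.⨯ :w)) ((:u V.· :w) V.⊙ :v V.⊟ (:u V.· :v) V.⊙ :w) (environment 𝟎ˢ u v w 0# 0#)

  ·-⨯ : ∀ u v → u · (u ⨯ v) ≈ 0#
  ·-⨯ u v = scalars (:u V.· (:u V.⨯ :v)) :0 (environment 𝟎ˢ u v 𝟎 0# 0#)

  ·-comm : ∀ u v → u · v ≈ v · u
  ·-comm u v = scalars (:u V.· :v) (:v V.· :u) (environment 𝟎ˢ u v 𝟎 0# 0#)

  matrix-symmetric : ∀ S u v → u · matrix S v ≈ v · matrix S u
  matrix-symmetric S u v = scalars
    (:u V.· V.matrix :S :v) (:v V.· V.matrix :S :u) (environment S u v 𝟎 0# 0#)

  ·-linear : ∀ u c v d w → u · (c ⊙ v ⊟ d ⊙ w) ≈ c * (u · v) - d * (u · w)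
  ·-linear u c v d w = scalars
    (:u V.· (:c V.⊙ :v V.⊟ :d V.⊙ :w)) (:c :* (:u V.· :v) :- :d :* (:u V.· :w))
    (environment 𝟎ˢ u v w c d)

  -- For v on the quadric: its second intersection with the line through v and w.
  secant : Symmetric Carrier → Triple Carrier → Triple Carrier → Triple Carrier
  secant S v w = form S w ⊙ v ⊟ ((1# + 1#) * (w · matrix S v)) ⊙ w

  -- Where `form S w` is nonzero, `secant S v w` is `form S w` times the reflection of `v` along
  -- `w`, and a reflection preserves the form.
  form-secant : ∀ S v w → form S (secant S v w) ≈ form S w * form S w * form S v
  form-secant S v w = scalars
    (V.form :S (V.form :S :w V.⊙ :v V.⊟ (:2 :* (:w V.· V.matrix :S :v)) V.⊙ :w))
    (V.form :S :w :* V.form :S :w :* V.form :S :v) (environment S 𝟎 v w 0# 0#)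

  -- Polarisation: this ties the derivative of the discriminant to the bilinear form of
  -- `-adjugate S`.
  disc-sub : ∀ S u v → disc S (u ⊟ v) - disc S (u ⊞ v) ≈
             - ((1# + 1#) * (1# + 1#) * (u · matrix (-adjugate S) v))
  disc-sub S u v = scalars
    (V.disc :S (:u V.⊟ :v) :- V.disc :S (:u V.⊞ :v))
    (:- (:2 :* :2 :* (:u V.· V.matrix (V.-adjugate :S) :v))) (environment S u v 𝟎 0# 0#)

  -- Keeping both error terms, for `s² = disc S L` and for `L · w = 0`, makes this an unconditional
  -- polynomial identity.
  form-eigenvector : ∀ S L w s → form S (eigenvector S L w s) ≈
               (s * s - disc S L) * form S w + (L · w) * (matrix S w · matrix (-adjugate S) L)
  form-eigenvector S L w s = scalars (V.form :S (V.eigenvector :S :u :w :c))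
     ((:c :* :c :- V.disc :S :u) :* V.form :S :w
       :+ (:u V.· :w) :* (V.matrix :S :w V.· V.matrix (V.-adjugate :S) :u))
     (environment S L 𝟎 w s 0#)

  ·-eigenvector : ∀ S L w s → L · eigenvector S L w s ≈ s * (L · w)
  ·-eigenvector S L w s = scalars (:u V.· V.eigenvector :S :u :w :c) (:c :* (:u V.· :w)) (environment S L 𝟎 w s 0#)

  -- Both double cross products are expanded, and the symmetry of `S` moves `polar S L` onto `v`,
  -- where an eigenvalue can be inserted.
  ⨯-eigenvector : ∀ S L v g s → v ⨯ eigenvector S L (L ⨯ g) s ≋
            (s * (g · v) + g · polar S L v) ⊙ L ⊟ (L · v) ⊙ (s ⊙ g ⊟ matrix S (L ⨯ g))
  ⨯-eigenvector S L v g s = vectors (:v V.⨯ V.eigenvector :S :u (:u V.⨯ :w) :c)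
     ((:c :* (:w V.· :v) :+ (:w V.· V.polar :S :u :v)) V.⊙ :u
       V.⊟ (:u V.· :v) V.⊙ (:c V.⊙ :w V.⊟ V.matrix :S (:u V.⨯ :w)))
     (environment S L v g s 0#)

  -- The terms `s ⊙ w` cancel between opposite roots. If both eigenvectors vanish, `form-⨯` then
  -- puts `w = L ⨯ g` on the conic.
  ·-eigenvector-sum : ∀ S L g w s →
    g · eigenvector S L w s + g · eigenvector S L w (- s) ≈ - ((1# + 1#) * (g · polar S L w))
  ·-eigenvector-sum S L g w s = scalars
    ((:v V.· V.eigenvector :S :u :w :c) :+ (:v V.· V.eigenvector :S :u :w (:- :c)))
    (:- (:2 :* (:v V.· V.polar :S :u :w))) (environment S L g w s 0#)

  ·-distrib-⊞ : ∀ u v w → (u ⊞ v) · w ≈ u · w + v · w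
  ·-distrib-⊞ u v w = scalars ((:u V.⊞ :v) V.· :w) ((:u V.· :w) :+ (:v V.· :w)) (environment 𝟎ˢ u v w 0# 0#)

  𝟎-zeroʳ : ∀ u → u · 𝟎 ≈ 0#
  𝟎-zeroʳ u = scalars (:u V.· V.𝟎) :0 (environment 𝟎ˢ u 𝟎 𝟎 0# 0#)

  ⨯-zeroʳ : ∀ u → u ⨯ 𝟎 ≋ 𝟎
  ⨯-zeroʳ u = vectors (:u V.⨯ V.𝟎) V.𝟎 (environment 𝟎ˢ u 𝟎 𝟎 0# 0#)

  polar-zeroʳ : ∀ S L → polar S L 𝟎 ≋ 𝟎
  polar-zeroʳ S L = vectors (V.polar :S :u V.𝟎) V.𝟎 (environment S L 𝟎 𝟎 0# 0#)

  combination-zero : ∀ {c d} u v → c ≈ 0# → d ≈ 0# → c ⊙ u ⊟ d ⊙ v ≋ 𝟎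
  combination-zero u v c≈0 d≈0 = ≋-trans
    (⊟-cong (⊙-cong c≈0 ⟨ refl , refl , refl ⟩) (⊙-cong d≈0 ⟨ refl , refl , refl ⟩))
    (vectors (:0 V.⊙ :u V.⊟ :0 V.⊙ :v) V.𝟎 (environment 𝟎ˢ u v 𝟎 0# 0#))

  ·-homogeneous : ∀ u c v → u · (c ⊙ v) ≈ c * (u · v)
  ·-homogeneous u c v = scalars (:u V.· (:c V.⊙ :v)) (:c :* (:u V.· :v)) (environment 𝟎ˢ u v 𝟎 c 0#)

  ⨯-anticommutative : ∀ u v → u ⨯ v ≋ (- 1#) ⊙ (v ⨯ u)
  ⨯-anticommutative u v = vectors (:u V.⨯ :v) ((:- :1) V.⊙ (:v V.⨯ :u)) (environment 𝟎ˢ u v 𝟎 0# 0#)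

  form-cong : ∀ S {v w} → v ≋ w → form S v ≈ form S w
  form-cong S {v} {w} v≋w = trans (·-congˡ v (matrix-cong S v≋w))
    (trans (·-comm v (matrix S w)) (trans (·-congˡ (matrix S w) v≋w) (·-comm (matrix S w) w)))

-- Arithmetic in a field with decidable apartness

module DiscreteField {p ℓ₁ ℓ₂} (K : HeytingField p ℓ₁ ℓ₂)
                     (_#?_ : Decidable (HeytingField._#_ K)) where

  open OverField K

  ring : CommutativeRing p ℓ₁
  ring = HeytingCommutativeRing.commutativeRing heytingCommutativeRing

  open RingSolver ring public
  open HeytingProperties heytingCommutativeRing public using (#-congʳ; x-0≈x; 1#0)
  open RingProperties (CommutativeRing.ring ring) public using (-0#≈0#)
  open SetoidReasoning setoid

  zero⊎nonzero : ∀ x → x ≈ 0# ⊎ x # 0#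
  zero⊎nonzero x with x #? 0#
  ... | yes x#0 = inj₂ x#0
  ... | no ¬x#0 = inj₁ (proj₁ (tight x 0#) ¬x#0)

  zero⇒¬nonzero : ∀ {x} → x ≈ 0# → ¬ x # 0#
  zero⇒¬nonzero x≈0 x#0 = #-irrefl x≈0 x#0

  nonzero-unless : ∀ {x} → ¬ x ≈ 0# → x # 0#
  nonzero-unless {x} x≉0 with zero⊎nonzero x
  ... | inj₁ x≈0 = contradiction x≈0 x≉0
  ... | inj₂ x#0 = x#0

  infix 9 _⁻¹
  _⁻¹ : ∀ {x} → x # 0# → Carrier
  x#0 ⁻¹ = proj₁ (#⇒invertible x#0)

  inverseʳ : ∀ {x} (x#0 : x # 0#) → x * x#0 ⁻¹ ≈ 1#
  inverseʳ {x} x#0 = trans (*-congʳ (sym (x-0≈x x))) (proj₂ (proj₂ (#⇒invertible x#0)))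

  cancel : ∀ {x y z} → x # 0# → x * y ≈ x * z → y ≈ z
  cancel {x} {y} {z} x#0 xy≈xz = modulo (inverseʳ x#0) {z - y} (modulo xy≈xz {x#0 ⁻¹}
    (solve 4 (λ x y z i → y := z :+ (z :- y) :* (x :* i :- :1) :+ i :* (x :* y :- x :* z))
      (x ∷ y ∷ z ∷ x#0 ⁻¹ ∷ [])))

  cancel-zero : ∀ {x y} → x # 0# → x * y ≈ 0# → y ≈ 0#
  cancel-zero {x} x#0 xy≈0 = cancel x#0 (trans xy≈0 (sym (zeroʳ x)))

  nonzeroˡ : ∀ {x y} → x * y # 0# → x # 0#
  nonzeroˡ {x} {y} xy#0 = nonzero-unless (λ x≈0 → zero⇒¬nonzero (trans (*-congʳ x≈0) (zeroˡ y)) xy#0)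

  nonzeroʳ : ∀ {x y} → x * y # 0# → y # 0#
  nonzeroʳ {x} {y} xy#0 = nonzeroˡ (#-congʳ (*-comm x y) xy#0)

  -x#0 : ∀ {x} → x # 0# → - x # 0#
  -x#0 {x} x#0 = nonzero-unless (λ -x≈0 → zero⇒¬nonzero
    (modulo -x≈0 (solve 1 (λ x → x := :0 :+ (:- :1) :* (:- x :- :0)) (x ∷ []))) x#0)

  quotient⇒product : ∀ {x y z} (y#0 : y # 0#) → x / y ⟨ y#0 ⟩ ≈ z → x ≈ z * y
  quotient⇒product {x} {y} {z} y#0 x/y≈z = modulo (inverseʳ y#0) { - x } (modulo x/y≈z {y}
    (solve 4 (λ x y z i → x := z :* y :+ (:- x) :* (y :* i :- :1) :+ y :* (x :* i :- z))
      (x ∷ y ∷ z ∷ y#0 ⁻¹ ∷ [])))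

  product⇒quotient : ∀ {x y z} (y#0 : y # 0#) → x ≈ z * y → x / y ⟨ y#0 ⟩ ≈ z
  product⇒quotient {x} {y} {z} y#0 x≈zy = modulo (inverseʳ y#0) {z} (modulo x≈zy {y#0 ⁻¹}
    (solve 4 (λ x y z i → x :* i := z :+ z :* (y :* i :- :1) :+ i :* (x :- z :* y))
      (x ∷ y ∷ z ∷ y#0 ⁻¹ ∷ [])))

-- Square values of quadratic polynomials and the cubic

module Quadratics {p ℓ₁ ℓ₂} (K : HeytingField p ℓ₁ ℓ₂)
                  (_#?_ : Decidable (HeytingField._#_ K))
                  (2#0 : HeytingField._#_ K (OverField.2# K) (HeytingField.0# K)) where

  open OverField K

  open DiscreteField K _#?_
  open SetoidReasoning setoid

  half : Carrier
  half = 2#0 ⁻¹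

  half#0 : half # 0#
  half#0 = nonzeroʳ {2#} (#-congʳ (sym (inverseʳ 2#0)) 1#0)

  4#0 : 4# # 0#
  4#0 = #-congʳ (solve 0 (:2 :* :2 := :4) []) (x#0y#0→xy#0 2#0 2#0)

  square-neg : ∀ x → (- x) ² ≈ x ²
  square-neg x = solve 1 (λ x → (:- x) :* (:- x) := x :* x) (x ∷ [])

  half-zero : ∀ {x} → x + x ≈ 0# → x ≈ 0#
  half-zero {x} 2x≈0 = cancel-zero 2#0 (trans (solve 1 (λ x → :2 :* x := x :+ x) (x ∷ [])) 2x≈0)

  -- If sum and difference both vanish, so do `2x` and `2y`. This selects the sign of a square root
  -- for which a sum is nonzero.
  nonzero-sign : ∀ {x y} → ¬ (x ≈ 0# × y ≈ 0#) → x + y # 0# ⊎ x - y # 0#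
  nonzero-sign {x} {y} ¬both with zero⊎nonzero (x + y) | zero⊎nonzero (x - y)
  ... | inj₂ x+y#0 | _ = inj₁ x+y#0
  ... | inj₁ _ | inj₂ x-y#0 = inj₂ x-y#0
  ... | inj₁ x+y≈0 | inj₁ x-y≈0 = contradiction (x≈0 , y≈0) ¬both
    where
    x≈0 = half-zero (modulo x+y≈0 {1#} (modulo x-y≈0 {1#}
      (solve 2 (λ x y → x :+ x := :0 :+ :1 :* (x :+ y :- :0) :+ :1 :* (x :- y :- :0)) (x ∷ y ∷ []))))
    y≈0 = half-zero (modulo x+y≈0 {1#} (modulo x-y≈0 { - 1# }
      (solve 2 (λ x y → y :+ y := :0 :+ :1 :* (x :+ y :- :0) :+ (:- :1) :* (x :- y :- :0)) (x ∷ y ∷ []))))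

  module _ {q₀ q₁ q₂ s : Carrier} (s² : s ² ≈ q₀) (q₁#0 : q₁ # 0#) where

    -- The line of slope m through (0 , s) meets y² = q₀ + q₁ u + q₂ u² again
    -- at u = (q₁ − 2 s m) / (m² − q₂).
    private
      slope : ∀ m → m ² - q₂ # 0# → q₁ - 2# * s * m # 0# →
              ∃[ u ] u # 0# × IsSquare (q₀ + u * q₁ + u ² * q₂)
      slope m d#0 n#0 = u , x#0y#0→xy#0 n#0 (nonzeroʳ {m ² - q₂} (#-congʳ (sym (inverseʳ d#0)) 1#0)) , s + m * u ,
        modulo s² {1#} (modulo (inverseʳ d#0) {u * n}
          (solve 6 (λ q₀ q₁ q₂ s m i → let n = q₁ :- :2 :* s :* m ; u = n :* i in
            (s :+ m :* u) :* (s :+ m :* u) :=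
            q₀ :+ u :* q₁ :+ u :* u :* q₂ :+ :1 :* (s :* s :- q₀) :+ (u :* n) :* ((m :* m :- q₂) :* i :- :1))
            (q₀ ∷ q₁ ∷ q₂ ∷ s ∷ m ∷ d#0 ⁻¹ ∷ [])))
        where
        n = q₁ - 2# * s * m
        u = n * d#0 ⁻¹

    -- Slope `0` serves if `q₂` is nonzero. Otherwise slopes `1` and `- 1` both have denominator
    -- `1`, and as `q₁` is nonzero, the numerators `q₁ - 2 s` and `q₁ + 2 s` cannot both vanish.
    another-square : ∃[ u ] u # 0# × IsSquare (q₀ + u * q₁ + u ² * q₂)
    another-square with zero⊎nonzero q₂
    ... | inj₂ q₂#0 = slope 0#
      (#-congʳ (solve 1 (λ x → :- x := :0 :* :0 :- x) (q₂ ∷ [])) (-x#0 q₂#0))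
      (#-congʳ (solve 2 (λ x s → x := x :- :2 :* s :* :0) (q₁ ∷ s ∷ [])) q₁#0)
    ... | inj₁ q₂≈0 with nonzero-sign {q₁} {2# * s} (λ (q₁≈0 , _) → zero⇒¬nonzero q₁≈0 q₁#0)
    ...   | inj₁ +#0 = slope (- 1#)
            (#-congʳ (modulo q₂≈0 {1#} (solve 1 (λ x → :1 := (:- :1) :* (:- :1) :- x :+ :1 :* (x :- :0))
              (q₂ ∷ []))) 1#0)
            (#-congʳ (solve 2 (λ x s → x :+ :2 :* s := x :- :2 :* s :* (:- :1)) (q₁ ∷ s ∷ [])) +#0)
    ...   | inj₂ -#0 = slope 1#
            (#-congʳ (modulo q₂≈0 {1#} (solve 1 (λ x → :1 := :1 :* :1 :- x :+ :1 :* (x :- :0))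
              (q₂ ∷ []))) 1#0)
            (#-congʳ (solve 2 (λ x s → x :- :2 :* s := x :- :2 :* s :* :1) (q₁ ∷ s ∷ [])) -#0)

  module _ {k τ y z : Carrier} (τ#0 : τ # 0#)
           (y² : y ² ≈ (2# + τ) ² - k * τ ²) (z² : z ² ≈ (2# - τ) ² - k * τ ²)
           (nondegenerate : ¬ (k ≈ 0# × (y ≈ 0# ⊎ z ≈ 0#))) where

    private
      CubicPoint : Set _
      CubicPoint = ∃[ X ] ∃[ Y ] OnCubic k X Y × (Y ² + 2# * X * Y + k * X ² # 0#
        × τ * (Y ² + 2# * X * Y + k * X ²) ≈ - (4# * X * Y))

      -- m is the slope Y / X of the point to be constructed; X is a root of
      -- X² − h X − 4 k m, whose discriminant is the square of z n / 2.
      with-root : ∀ {y} → y ² ≈ (2# + τ) ² - k * τ ² → (2# + τ) + y # 0# → CubicPoint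
      -- The sign of `ζ` is chosen so that the root `X = (h ± ζ) / 2` is nonzero.
      with-root {y} y² w#0 = [ from-root ζ² , from-root (trans (square-neg ζ) ζ²) ]′ (nonzero-sign ¬both)
        where
        w = (2# + τ) + y
        m = - (w * τ#0 ⁻¹)
        n = m ² + 2# * m + k
        h = m ² + 4# * m - k
        ζ = half * (z * n)

        mτ : m * τ ≈ - w
        mτ = modulo (inverseʳ τ#0) { - w }
          (solve 3 (λ w τ i → (:- (w :* i)) :* τ := :- w :+ (:- w) :* (τ :* i :- :1)) (w ∷ τ ∷ τ#0 ⁻¹ ∷ []))

        -- For `Y = m X` the denominator `Y² + 2XY + kX²` is `X² n`. Inserting `m τ = - w` turns
        -- `τ² n` into `w² - 2 τ w + k τ²`, which the equation for `y²` reduces to `4 w`.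
        τ²n : τ ² * n ≈ 4# * w
        τ²n = modulo mτ {m * τ - w + 2# * τ} (modulo y² {1#}
          (solve 4 (λ k τ y m → let w = (:2 :+ τ) :+ y in
            τ :* τ :* (m :* m :+ :2 :* m :+ k) :=
            :4 :* w :+ (m :* τ :- w :+ :2 :* τ) :* (m :* τ :- :- w)
              :+ :1 :* (y :* y :- ((:2 :+ τ) :* (:2 :+ τ) :- k :* (τ :* τ))))
            (k ∷ τ ∷ y ∷ m ∷ [])))

        n#0 : n # 0#
        n#0 = nonzeroʳ {τ ²} (#-congʳ (sym τ²n) (x#0y#0→xy#0 4#0 w#0))

        m#0 : m # 0#
        m#0 = nonzeroˡ {m} {τ} (#-congʳ (sym mτ) (-x#0 w#0))

        -- This inverts the parametrisation: `τ = - 4 m / n`, which is `- 4XY / (Y² + 2XY + kX²)`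
        -- for `Y = m X`.
        nτ : n * τ ≈ - (4# * m)
        nτ = cancel τ#0 (modulo mτ {4#} (modulo τ²n {1#} (solve 4 (λ τ n w m →
          τ :* (n :* τ) := τ :* (:- (:4 :* m)) :+ :4 :* (m :* τ :- :- w) :+ :1 :* (τ :* τ :* n :- :4 :* w))
          (τ ∷ n ∷ w ∷ m ∷ []))))

        -- Inserting `n τ = - 4 m` into the equation for `z²` gives `(2 n + 4 m)² - 16 k m²`, where
        -- `n + 2 m = h + 2 k`.
        z²n² : (z * n) ² ≈ 4# * (h ² + 4# * 4# * (k * m))
        z²n² = modulo nτ {(1# - k) * (n * τ - 4# * m) - 4# * n} (modulo z² {n ²}
          (solve 4 (λ k τ z m → let n = m :* m :+ :2 :* m :+ k ; h = m :* m :+ :4 :* m :- k in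
            (z :* n) :* (z :* n) :=
            :4 :* (h :* h :+ :4 :* :4 :* (k :* m))
              :+ ((:1 :- k) :* (n :* τ :- :4 :* m) :- :4 :* n) :* (n :* τ :- :- (:4 :* m))
              :+ (n :* n) :* (z :* z :- ((:2 :- τ) :* (:2 :- τ) :- k :* (τ :* τ))))
            (k ∷ τ ∷ z ∷ m ∷ [])))

        ζ² : ζ ² ≈ h ² + 4# * 4# * (k * m)
        ζ² = modulo (inverseʳ 2#0) {(2# * half + 1#) * (h ² + 4# * 4# * (k * m))} (modulo z²n² {half ²}
          (solve 3 (λ i x r → (i :* x) :* (i :* x) :=
            r :+ ((:2 :* i :+ :1) :* r) :* (:2 :* i :- :1) :+ (i :* i) :* (x :* x :- :4 :* r))
            (half ∷ z * n ∷ h ² + 4# * 4# * (k * m) ∷ [])))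

        -- A double root at zero would give `16 k m = 0` and `z n = 0`, hence `k = 0` and `z = 0`,
        -- the excluded case.
        ¬both : ¬ (h ≈ 0# × ζ ≈ 0#)
        ¬both (h≈0 , ζ≈0) = nondegenerate (k≈0 , inj₂ z≈0)
          where
          z≈0 = cancel-zero n#0 (trans (*-comm n z) (cancel-zero half#0 ζ≈0))
          k≈0 = cancel-zero m#0 (cancel-zero 4#0 (cancel-zero 4#0
            (modulo h≈0 { - h } (modulo ζ≈0 {ζ} (modulo ζ² { - 1# }
              (solve 4 (λ k m h ζ → :4 :* (:4 :* (m :* k)) :=
                :0 :+ (:- h) :* (h :- :0) :+ ζ :* (ζ :- :0) :+ (:- :1) :* (ζ :* ζ :- (h :* h :+ :4 :* :4 :* (k :* m))))
                (k ∷ m ∷ h ∷ ζ ∷ [])))))))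

        -- On the line `Y = m X` the cubic equation is `X` times the quadratic one. A nonzero root
        -- `X` also keeps the denominator `X² n` nonzero.
        from-root : ∀ {ζ} → ζ ² ≈ h ² + 4# * 4# * (k * m) → h + ζ # 0# → CubicPoint
        from-root {ζ} ζ² h+ζ#0 = X , m * X ,
          modulo X² { - X } (solve 3 (λ k m X → let Y = m :* X ; h = m :* m :+ :4 :* m :- k in
            Y :* Y :+ :4 :* X :* Y :+ :4 :* k :* Y :=
            X :* (X :* X) :+ k :* (X :* X) :+ (:- X) :* (X :* X :- (h :* X :+ :4 :* (k :* m))))
            (k ∷ m ∷ X ∷ [])) ,
          #-congʳ (solve 3 (λ k m X → let Y = m :* X in
            (X :* X) :* (m :* m :+ :2 :* m :+ k) := Y :* Y :+ :2 :* X :* Y :+ k :* (X :* X))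
            (k ∷ m ∷ X ∷ [])) (x#0y#0→xy#0 (x#0y#0→xy#0 X#0 X#0) n#0) ,
          modulo nτ {X ²} (solve 4 (λ k τ m X → let Y = m :* X in
            τ :* (Y :* Y :+ :2 :* X :* Y :+ k :* (X :* X)) :=
            :- (:4 :* X :* Y) :+ (X :* X) :* ((m :* m :+ :2 :* m :+ k) :* τ :- :- (:4 :* m)))
            (k ∷ τ ∷ m ∷ X ∷ []))
          where
          X = half * (h + ζ)

          X#0 : X # 0#
          X#0 = x#0y#0→xy#0 half#0 h+ζ#0

          X² : X ² ≈ h * X + 4# * (k * m)
          X² = cancel 4#0 (modulo (inverseʳ 2#0) {(h + ζ) * (2# * X - h + ζ)} (modulo ζ² {1#}
            (solve 5 (λ k m h ζ i → let X = i :* (h :+ ζ) in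
              :4 :* (X :* X) := :4 :* (h :* X :+ :4 :* (k :* m))
                :+ ((h :+ ζ) :* (:2 :* X :- h :+ ζ)) :* (:2 :* i :- :1)
                :+ :1 :* (ζ :* ζ :- (h :* h :+ :4 :* :4 :* (k :* m))))
              (k ∷ m ∷ h ∷ ζ ∷ half ∷ []))))

    -- The sign of `y` is free and is chosen to make `2 + τ + y` nonzero. Failure of both signs
    -- would force `k τ² = 0` and `y = 0`.
    cubic-point : CubicPoint
    cubic-point = [ with-root y² , with-root (trans (square-neg y) y²) ]′ (nonzero-sign ¬both)
      where
      ¬both : ¬ (2# + τ ≈ 0# × y ≈ 0#)
      ¬both (2+τ≈0 , y≈0) = nondegenerate (cancel-zero (x#0y#0→xy#0 τ#0 τ#0)
        (modulo 2+τ≈0 {2# + τ} (modulo y≈0 { - y } (modulo y² {1#}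
          (solve 3 (λ k τ y → (τ :* τ) :* k := :0 :+ (:2 :+ τ) :* (:2 :+ τ :- :0) :+ (:- y) :* (y :- :0)
            :+ :1 :* (y :* y :- ((:2 :+ τ) :* (:2 :+ τ) :- k :* (τ :* τ)))) (k ∷ τ ∷ y ∷ []))))) , inj₁ y≈0)

-- Rational points of a conic on a line

module Conics {p ℓ₁ ℓ₂} (K : HeytingField p ℓ₁ ℓ₂)
              (_#?_ : Decidable (HeytingField._#_ K))
              (2#0 : HeytingField._#_ K (OverField.2# K) (HeytingField.0# K)) where

  open OverField K hiding (Coordinates; ⟨_,_,_⟩; x₁; x₂; x₀)

  open DiscreteField K _#?_
  open Quadratics K _#?_ 2#0
  open Identities ring
  open VectorAlgebra (CommutativeRing.rawRing ring) hiding (_-_)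
  open Triple
  open SetoidReasoning setoid

  Vector : Set p
  Vector = Triple Carrier

  -- The witness is a functional rather than a coordinate, so that a vector equation can be paired
  -- with `g` and then cancelled.
  Apart : Vector → Set _
  Apart v = ∃[ g ] g · v # 0#

  apart⇒¬zero : ∀ {v} → Apart v → ¬ v ≋ 𝟎
  apart⇒¬zero (g , g·v#0) v≋𝟎 = zero⇒¬nonzero (trans (·-congˡ g v≋𝟎) (𝟎-zeroʳ g)) g·v#0

  e₁ e₂ e₃ : Vector
  e₁ = ⟨ 1# , 0# , 0# ⟩
  e₂ = ⟨ 0# , 1# , 0# ⟩
  e₃ = ⟨ 0# , 0# , 1# ⟩

  e₁· : ∀ v → e₁ · v ≈ x₁ v
  e₁· ⟨ x , y , z ⟩ = solve 3 (λ x y z → :1 :* x :+ :0 :* y :+ :0 :* z := x) (x ∷ y ∷ z ∷ [])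

  e₂· : ∀ v → e₂ · v ≈ x₂ v
  e₂· ⟨ x , y , z ⟩ = solve 3 (λ x y z → :0 :* x :+ :1 :* y :+ :0 :* z := y) (x ∷ y ∷ z ∷ [])

  e₃· : ∀ v → e₃ · v ≈ x₀ v
  e₃· ⟨ x , y , z ⟩ = solve 3 (λ x y z → :0 :* x :+ :0 :* y :+ :1 :* z := z) (x ∷ y ∷ z ∷ [])

  apart₁ : ∀ {v} → x₁ v # 0# → Apart v
  apart₁ x#0 = e₁ , #-congʳ (sym (e₁· _)) x#0

  apart₂ : ∀ {v} → x₂ v # 0# → Apart v
  apart₂ x#0 = e₂ , #-congʳ (sym (e₂· _)) x#0

  apart₀ : ∀ {v} → x₀ v # 0# → Apart v
  apart₀ x#0 = e₃ , #-congʳ (sym (e₃· _)) x#0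

  zero⊎apart : ∀ v → v ≋ 𝟎 ⊎ Apart v
  zero⊎apart v with zero⊎nonzero (x₁ v) | zero⊎nonzero (x₂ v) | zero⊎nonzero (x₀ v)
  ... | inj₂ x₁#0 | _ | _ = inj₂ (apart₁ x₁#0)
  ... | inj₁ _ | inj₂ x₂#0 | _ = inj₂ (apart₂ x₂#0)
  ... | inj₁ _ | inj₁ _ | inj₂ x₀#0 = inj₂ (apart₀ x₀#0)
  ... | inj₁ x₁≈0 | inj₁ x₂≈0 | inj₁ x₀≈0 = inj₁ ⟨ x₁≈0 , x₂≈0 , x₀≈0 ⟩

  -- If `g` kills `v` and `h` kills `u`, then `g ⊞ h` agrees with `g` on `u` and with `h` on `v`.
  common : ∀ {u v} → Apart u → Apart v → ∃[ g ] g · u # 0# × g · v # 0#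
  common {u} {v} (g , g·u#0) (h , h·v#0) with zero⊎nonzero (g · v) | zero⊎nonzero (h · u)
  ... | inj₂ g·v#0 | _ = g , g·u#0 , g·v#0
  ... | inj₁ _ | inj₂ h·u#0 = h , h·u#0 , h·v#0
  ... | inj₁ g·v≈0 | inj₁ h·u≈0 = g ⊞ h ,
    #-congʳ (sym (trans (·-distrib-⊞ g h u) (trans (+-congˡ h·u≈0) (+-identityʳ _)))) g·u#0 ,
    #-congʳ (sym (trans (·-distrib-⊞ g h v) (trans (+-congʳ g·v≈0) (+-identityˡ _)))) h·v#0

  -- Expanding `g ⨯ (v ⨯ w) = 𝟎` gives `(g · w) v = (g · v) w`, and `g · v` is invertible.
  parallel : ∀ {v w} → Apart v → v ⨯ w ≋ 𝟎 → ∃[ c ] w ≋ c ⊙ v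
  parallel {v} {w} (g , g·v#0) v⨯w≋𝟎 = g · w * g·v#0 ⁻¹ , ⟨ coordinate ≈₁ , coordinate ≈₂ , coordinate ≈₀ ⟩
    where
    open _≋_ (≋-trans (≋-sym (⨯-⨯ g v w)) (≋-trans (⨯-congˡ g v⨯w≋𝟎) (⨯-zeroʳ g)))

    coordinate : ∀ {x y} → (g · w) * x - (g · v) * y ≈ 0# → y ≈ g · w * g·v#0 ⁻¹ * x
    coordinate {x} {y} e = modulo (inverseʳ g·v#0) { - y } (modulo e { - (g·v#0 ⁻¹) }
      (solve 5 (λ x y gv gw i → y := gw :* i :* x :+ (:- y) :* (gv :* i :- :1)
        :+ (:- i) :* (gw :* x :- gv :* y :- :0)) (x ∷ y ∷ g · v ∷ g · w ∷ g·v#0 ⁻¹ ∷ [])))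

  -- Up to sign, every coordinate of `u` occurs in `u ⨯ e₁` or `u ⨯ e₂`.
  apart-⨯ : ∀ {u} → Apart u → ∃[ g ] Apart (u ⨯ g)
  apart-⨯ {u@(⟨ x , y , z ⟩)} u#𝟎 with zero⊎apart (u ⨯ e₁) | zero⊎apart (u ⨯ e₂)
  ... | inj₂ u⨯e₁#𝟎 | _ = e₁ , u⨯e₁#𝟎
  ... | inj₁ _ | inj₂ u⨯e₂#𝟎 = e₂ , u⨯e₂#𝟎
  ... | inj₁ ⟨ _ , z≈0 , y≈0 ⟩ | inj₁ ⟨ _ , _ , x≈0 ⟩ = contradiction
    ⟨ modulo x≈0 {1#} (solve 2 (λ x y → x := :0 :+ :1 :* (x :* :1 :- y :* :0 :- :0)) (x ∷ y ∷ []))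
    , modulo y≈0 { - 1# } (solve 2 (λ x y → y := :0 :+ (:- :1) :* (x :* :0 :- y :* :1 :- :0)) (x ∷ y ∷ []))
    , modulo z≈0 {1#} (solve 2 (λ x z → z := :0 :+ :1 :* (z :* :1 :- x :* :0 :- :0)) (x ∷ z ∷ [])) ⟩
    (apart⇒¬zero u#𝟎)

  module _ (S : Symmetric Carrier) where

    -- `⨯-polar` makes `v` an eigenvector. Applying the polar map twice multiplies `v` by `c²` and,
    -- on the plane `L · v = 0`, by `disc S L`; pairing with `g` cancels `v`.
    eigenvalue : ∀ {L v} → Apart v → L · v ≈ 0# → form S v ≈ 0# →
                 ∃[ c ] polar S L v ≋ c ⊙ v × c ² ≈ disc S L
    eigenvalue {L} {v} v#𝟎@(g , g·v#0) L·v≈0 Q≈0 = c , Tv≋cv , cancel g·v#0 (begin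
      (g · v) * c ²
        ≈⟨ solve 2 (λ x c → x :* (c :* c) := c :* (c :* x)) (g · v ∷ c ∷ []) ⟩
      c * (c * (g · v))                          ≈⟨ *-congˡ (·-homogeneous g c v) ⟨
      c * (g · (c ⊙ v))                          ≈⟨ *-congˡ (·-congˡ g Tv≋cv) ⟨
      c * (g · polar S L v)                      ≈⟨ ·-homogeneous g c _ ⟨
      g · (c ⊙ polar S L v)                      ≈⟨ ·-congˡ g (polar-homogeneous S L c v) ⟨
      g · polar S L (c ⊙ v)                      ≈⟨ ·-congˡ g (polar-cong S L Tv≋cv) ⟨
      g · polar S L (polar S L v)                ≈⟨ ·-congˡ g (polar-polar S L L v) ⟩
      g · (disc S L ⊙ v ⊟ (L · v) ⊙ matrix (-adjugate S) L)  ≈⟨ ·-linear g _ v _ _ ⟩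
      disc S L * (g · v) - (L · v) * (g · matrix (-adjugate S) L)
        ≈⟨ modulo L·v≈0 { - (g · matrix (-adjugate S) L) }
          (solve 4 (λ d x y z → d :* x :- y :* z := x :* d :+ (:- z) :* (y :- :0))
          (disc S L ∷ g · v ∷ L · v ∷ g · matrix (-adjugate S) L ∷ [])) ⟩
      (g · v) * disc S L                         ∎)
      where
      eigen : ∃[ c ] polar S L v ≋ c ⊙ v
      eigen = parallel v#𝟎 (≋-trans (⨯-polar S L v) (combination-zero L (matrix S v) Q≈0 L·v≈0))
      c = proj₁ eigen
      Tv≋cv = proj₂ eigen

    -- The last hypothesis covers two cases: `s = - c`, where the eigenvalues agree, and
    -- `g · v = 0`, where any `s` will do.
    ⨯-eigenvector-zero : ∀ {L v c s} g → L · v ≈ 0# → polar S L v ≋ c ⊙ v → (s + c) * (g · v) ≈ 0# →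
                   v ⨯ eigenvector S L (L ⨯ g) s ≋ 𝟎
    ⨯-eigenvector-zero {L} {v} {c} {s} g L·v≈0 Tv≋cv e =
      ≋-trans (⨯-eigenvector S L v g s) (combination-zero L _ κ≈0 L·v≈0)
      where
      κ≈0 : s * (g · v) + g · polar S L v ≈ 0#
      κ≈0 = begin
        s * (g · v) + g · polar S L v    ≈⟨ +-congˡ (trans (·-congˡ g Tv≋cv) (·-homogeneous g c v)) ⟩
        s * (g · v) + c * (g · v)        ≈⟨ distribʳ (g · v) s c ⟨
        (s + c) * (g · v)                ≈⟨ e ⟩
        0#                               ∎

    eigenvector-on-conic : ∀ {L w s} → s ² ≈ disc S L → L · w ≈ 0# → form S (eigenvector S L w s) ≈ 0#
    eigenvector-on-conic {L} {w} {s} s² L·w≈0 = trans (form-eigenvector S L w s)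
      (modulo s² {form S w} (modulo L·w≈0 {matrix S w · matrix (-adjugate S) L}
        (solve 5 (λ s d q x y → (s :* s :- d) :* q :+ x :* y := :0 :+ q :* (s :* s :- d) :+ y :* (x :- :0))
          (s ∷ disc S L ∷ form S w ∷ L · w ∷ matrix S w · matrix (-adjugate S) L ∷ []))))

    eigenvector-on-line : ∀ {L w} s → L · w ≈ 0# → L · eigenvector S L w s ≈ 0#
    eigenvector-on-line {L} {w} s L·w≈0 = trans (·-eigenvector S L w s) (trans (*-congˡ L·w≈0) (zeroʳ s))

    -- Some `w = L ⨯ g` is nonzero. If its eigenvectors for `s` and `- s` both vanish, `w` itself
    -- lies on the conic.
    rational-point : ∀ {L s} → Apart L → s ² ≈ disc S L → ∃[ v ] Apart v × form S v ≈ 0# × L · v ≈ 0#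
    rational-point {L} {s} L#𝟎 s² with apart-⨯ L#𝟎
    ... | g , w#𝟎 with zero⊎apart (eigenvector S L (L ⨯ g) s) | zero⊎apart (eigenvector S L (L ⨯ g) (- s))
    ...   | inj₂ v#𝟎 | _ = _ , v#𝟎 , eigenvector-on-conic s² (·-⨯ L g) , eigenvector-on-line s (·-⨯ L g)
    ...   | inj₁ _ | inj₂ v#𝟎 =
      _ , v#𝟎 , eigenvector-on-conic (trans (square-neg s) s²) (·-⨯ L g) , eigenvector-on-line (- s) (·-⨯ L g)
    ...   | inj₁ +≋𝟎 | inj₁ -≋𝟎 = L ⨯ g , w#𝟎 , Q≈0 , ·-⨯ L g
      where
      w = L ⨯ g

      Q≈0 : form S w ≈ 0#
      Q≈0 = half-zero (begin
        form S w + form S w                            ≈⟨ +-cong (form-⨯ S L g) (form-⨯ S L g) ⟩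
        - (g · polar S L w) + - (g · polar S L w)
          ≈⟨ solve 1 (λ x → :- x :+ :- x := :- (:2 :* x)) (g · polar S L w ∷ []) ⟩
        - (2# * (g · polar S L w))                     ≈⟨ ·-eigenvector-sum S L g w s ⟨
        g · eigenvector S L w s + g · eigenvector S L w (- s)      ≈⟨ +-cong (·-congˡ g +≋𝟎) (·-congˡ g -≋𝟎) ⟩
        g · 𝟎 + g · 𝟎                                  ≈⟨ +-cong (𝟎-zeroʳ g) (𝟎-zeroʳ g) ⟩
        0# + 0#                                        ≈⟨ +-identityʳ 0# ⟩
        0#                                             ∎)

    -- In the application this pairing is `Disc′ t₀` up to the factor `- 2`, and `β` is the line on
    -- which the denominator of `ℓ` vanishes.
    module _ {L β : Vector} (transversal : L · matrix (-adjugate S) β # 0#) where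

      line-apart : Apart L
      line-apart = matrix (-adjugate S) β , #-congʳ (·-comm L _) transversal

      β-apart : Apart β
      β-apart = matrix (-adjugate S) L , #-congʳ (trans (matrix-symmetric (-adjugate S) L β) (·-comm β _)) transversal

      -- If `matrix S v` were zero, so would be `polar S L (polar S β v)`, which on the line `L` is
      -- a nonzero multiple of `v`.
      nonsingular : ∀ {v} → Apart v → L · v ≈ 0# → Apart (matrix S v)
      nonsingular {v} (g , g·v#0) L·v≈0 with zero⊎apart (matrix S v)
      ... | inj₂ Mv#𝟎 = Mv#𝟎
      ... | inj₁ Mv≋𝟎 = contradiction (begin
        g · 𝟎
          ≈⟨ ·-congˡ g (≋-trans (polar-cong S L (≋-trans (⨯-congˡ β Mv≋𝟎) (⨯-zeroʳ β))) (polar-zeroʳ S L)) ⟨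
        g · polar S L (polar S β v)                       ≈⟨ ·-congˡ g (polar-polar S L β v) ⟩
        g · ((L · matrix (-adjugate S) β) ⊙ v ⊟ (L · v) ⊙ matrix (-adjugate S) β)  ≈⟨ ·-linear g _ v _ _ ⟩
        (L · matrix (-adjugate S) β) * (g · v) - (L · v) * (g · matrix (-adjugate S) β)
          ≈⟨ modulo L·v≈0 { - (g · matrix (-adjugate S) β) }
            (solve 3 (λ x y z → x :- y :* z := x :+ (:- z) :* (y :- :0))
            ((L · matrix (-adjugate S) β) * (g · v) ∷ L · v ∷ g · matrix (-adjugate S) β ∷ [])) ⟩
        (L · matrix (-adjugate S) β) * (g · v)            ∎)
        (λ e → zero⇒¬nonzero (trans (sym e) (𝟎-zeroʳ g)) (x#0y#0→xy#0 transversal g·v#0))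

      -- The point `y` lies neither on the tangent at `v` nor on the line `β`, so the second
      -- intersection of the conic with the line through `v` and `y` leaves `β`.
      second-point : ∀ {v y} → form S v ≈ 0# → β · v ≈ 0# → y · matrix S v # 0# → y · β # 0# →
                     ∃[ v ] form S v ≈ 0# × β · v # 0#
      second-point {v} {y} Q≈0 β·v≈0 y·Mv#0 y·β#0 =
        secant S v y ,
        trans (form-secant S v y) (trans (*-congˡ Q≈0) (zeroʳ _)) ,
        #-congʳ (sym β·secant) (-x#0 (x#0y#0→xy#0 (x#0y#0→xy#0 2#0 y·Mv#0) (#-congʳ (·-comm y β) y·β#0)))
        where
        β·secant : β · secant S v y ≈ - (2# * (y · matrix S v) * (β · y))
        β·secant = begin
          β · secant S v y
            ≈⟨ ·-linear β (form S y) v (2# * (y · matrix S v)) y ⟩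
          form S y * (β · v) - 2# * (y · matrix S v) * (β · y)
            ≈⟨ +-congʳ (trans (*-congˡ β·v≈0) (zeroʳ (form S y))) ⟩
          0# - 2# * (y · matrix S v) * (β · y)                   ≈⟨ +-identityˡ _ ⟩
          - (2# * (y · matrix S v) * (β · y))                    ∎

      -- If the rational point found on `L` also lies on `β`, `common` supplies a `y` off `β` and
      -- off the tangent for `second-point`.
      finite-point : ∀ {s} → s ² ≈ disc S L → ∃[ v ] form S v ≈ 0# × β · v # 0#
      finite-point s² = 
        let v , v#𝟎 , Q≈0 , L·v≈0 = rational-point line-apart s²
            y , y·Mv#0 , y·β#0 = common (nonsingular v#𝟎 L·v≈0) β-apart
        in [ (λ β·v≈0 → second-point Q≈0 β·v≈0 y·Mv#0 y·β#0) , (λ β·v#0 → v , Q≈0 , β·v#0) ]′ (zero⊎nonzero (β · v))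

-- Fibres of the linear map as lines

module Progressions {p ℓ₁ ℓ₂} (K : HeytingField p ℓ₁ ℓ₂)
                    (_#?_ : Decidable (HeytingField._#_ K))
                    (2#0 : HeytingField._#_ K (OverField.2# K) (HeytingField.0# K))
                    (𝒞 : OverField.Conic K) (ℒ : OverField.LinearMap K) where

  open OverField K

  open ConicWithMap 𝒞 ℒ
  open Conic 𝒞
  open LinearMap ℒ
  open DiscreteField K _#?_
  open Quadratics K _#?_ 2#0
  open Identities ring
  open Conics K _#?_ 2#0
  open VectorAlgebra (CommutativeRing.rawRing ring) hiding (_-_)
  open SetoidReasoning setoid

  S : Symmetric Carrier
  S = record { A = A ; B = B ; C = C ; D = D ; E = E ; F = F }

  α β : Vector
  α = ⟨ a , b , c ⟩
  β = ⟨ d , e , f ⟩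

  -- The fibre of ℓ over t is cut out by the line L t.
  L : Carrier → Vector
  L t = ⟨ a - d * t , b - e * t , c - f * t ⟩

  vector : Coordinates → Vector
  vector ⟨ x , y , z ⟩ = ⟨ x , y , z ⟩

  -- Evaluation and Taylor expansion of the discriminant

  eval-⊕ : ∀ g h t → eval (g ⊕ h) t ≈ eval g t + eval h t
  eval-⊕ [] h t = sym (+-identityˡ _)
  eval-⊕ (x ∷ g) [] t = sym (+-identityʳ _)
  eval-⊕ (x ∷ g) (y ∷ h) t = begin
    x + y + t * eval (g ⊕ h) t                ≈⟨ +-congˡ (*-congˡ (eval-⊕ g h t)) ⟩
    x + y + t * (eval g t + eval h t)
      ≈⟨ solve 5 (λ x y t g h → x :+ y :+ t :* (g :+ h) := (x :+ t :* g) :+ (y :+ t :* h))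
        (x ∷ y ∷ t ∷ eval g t ∷ eval h t ∷ []) ⟩
    (x + t * eval g t) + (y + t * eval h t)   ∎

  eval-map : ∀ x g t → eval (map (x *_) g) t ≈ x * eval g t
  eval-map x [] t = sym (zeroʳ x)
  eval-map x (y ∷ g) t = trans (+-congˡ (*-congˡ (eval-map x g t)))
    (solve 4 (λ x y t g → x :* y :+ t :* (x :* g) := x :* (y :+ t :* g)) (x ∷ y ∷ t ∷ eval g t ∷ []))

  eval-⊗ : ∀ g h t → eval (g ⊗ h) t ≈ eval g t * eval h t
  eval-⊗ [] h t = sym (zeroˡ _)
  eval-⊗ (x ∷ g) h t = begin
    eval (map (x *_) h ⊕ (0# ∷ g ⊗ h)) t                ≈⟨ eval-⊕ (map (x *_) h) (0# ∷ g ⊗ h) t ⟩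
    eval (map (x *_) h) t + (0# + t * eval (g ⊗ h) t)
      ≈⟨ +-cong (eval-map x h t) (+-congˡ (*-congˡ (eval-⊗ g h t))) ⟩
    x * eval h t + (0# + t * (eval g t * eval h t))
      ≈⟨ solve 4 (λ x t g h → x :* h :+ (:0 :+ t :* (g :* h)) := (x :+ t :* g) :* h)
        (x ∷ t ∷ eval g t ∷ eval h t ∷ []) ⟩
    (x + t * eval g t) * eval h t                       ∎

  eval-dot : ∀ g₁ g₂ g₀ h₁ h₂ h₀ t → eval (dot (g₁ ∷ g₂ ∷ g₀ ∷ []) (h₁ ∷ h₂ ∷ h₀ ∷ [])) t ≈
             eval g₁ t * eval h₁ t + (eval g₂ t * eval h₂ t + (eval g₀ t * eval h₀ t + 0#))
  eval-dot g₁ g₂ g₀ h₁ h₂ h₀ t = trans (eval-⊕ (g₁ ⊗ h₁) _ t) (+-cong (eval-⊗ g₁ h₁ t)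
    (trans (eval-⊕ (g₂ ⊗ h₂) _ t) (+-cong (eval-⊗ g₂ h₂ t)
    (trans (eval-⊕ (g₀ ⊗ h₀) [] t) (+-congʳ (eval-⊗ g₀ h₀ t))))))

  eval-pencil : ∀ g₁ g₂ g₀ t →
                eval (dot pencil (g₁ ∷ g₂ ∷ g₀ ∷ [])) t ≈ L t · ⟨ eval g₁ t , eval g₂ t , eval g₀ t ⟩
  eval-pencil g₁ g₂ g₀ t = trans (eval-dot (a ∷ - d ∷ []) (b ∷ - e ∷ []) (c ∷ - f ∷ []) g₁ g₂ g₀ t)
    (solve 10 (λ a b c d e f t x y z → let lin = λ u v → u :+ t :* (:- v :+ t :* :0) in
      lin a d :* x :+ (lin b e :* y :+ (lin c f :* z :+ :0)) :=
      (a :- d :* t) :* x :+ (b :- e :* t) :* y :+ (c :- f :* t) :* z)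
      (a ∷ b ∷ c ∷ d ∷ e ∷ f ∷ t ∷ eval g₁ t ∷ eval g₂ t ∷ eval g₀ t ∷ []))

  eval-row : ∀ x y z t → eval (dot ((x ∷ []) ∷ (y ∷ []) ∷ (z ∷ []) ∷ []) pencil) t ≈ ⟨ x , y , z ⟩ · L t
  eval-row x y z t = trans (eval-dot
    (x ∷ []) (y ∷ []) (z ∷ []) (a ∷ - d ∷ []) (b ∷ - e ∷ []) (c ∷ - f ∷ []) t)
    (solve 10 (λ a b c d e f t x y z → let lin = λ u v → u :+ t :* (:- v :+ t :* :0) ; const = λ u → u :+ t :* :0 in
      const x :* lin a d :+ (const y :* lin b e :+ (const z :* lin c f :+ :0)) :=
      x :* (a :- d :* t) :+ y :* (b :- e :* t) :+ z :* (c :- f :* t))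
      (a ∷ b ∷ c ∷ d ∷ e ∷ f ∷ t ∷ x ∷ y ∷ z ∷ []))

  -- Evaluation respects sums and products, so it carries `dot` of coefficient lists to `_·_` of
  -- their values.
  Disc≈disc : ∀ t → Disc t ≈ disc S (L t)
  Disc≈disc t = trans (eval-pencil (row N.A N.B N.D) (row N.B N.C N.E) (row N.D N.E N.F) t)
    (·-congˡ (L t) ⟨ eval-row N.A N.B N.D t , eval-row N.B N.C N.E t , eval-row N.D N.E N.F t ⟩)
    where
    module N = Symmetric (-adjugate S)

    row : Carrier → Carrier → Carrier → Poly
    row x y z = dot ((x ∷ []) ∷ (y ∷ []) ∷ (z ∷ []) ∷ []) pencil

  taylor : ∀ c₀ c₁ c₂ t u → let g = c₀ ∷ c₁ ∷ c₂ ∷ [] in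
           eval g (t + u) ≈ eval g t + u * eval (derivative g) t + u ² * c₂
           × eval (derivative (derivative g)) t ≈ 2# * c₂
  taylor c₀ c₁ c₂ t u =
    solve 5 (λ c₀ c₁ c₂ t u →
      let eval₃ = λ c₀ c₁ c₂ t → c₀ :+ t :* (c₁ :+ t :* (c₂ :+ t :* :0)) in
      eval₃ c₀ c₁ c₂ (t :+ u) :=
      -- The summands `:0` and the trailing zero coefficient are exactly what `derivative` computes.
      eval₃ c₀ c₁ c₂ t :+ u :* eval₃ (c₁ :+ :0) (c₂ :+ (c₂ :+ :0)) :0 t :+ u :* u :* c₂)
      (c₀ ∷ c₁ ∷ c₂ ∷ t ∷ u ∷ []) ,
    solve 2 (λ c₂ t → (c₂ :+ (c₂ :+ :0) :+ :0) :+ t :* ((:0 :+ (:0 :+ :0)) :+ t :* (:0 :+ t :* :0)) := :2 :* c₂)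
      (c₂ ∷ t ∷ [])

  -- `discriminant` reduces to a list of three coefficients, which unification reads off; the last
  -- one becomes the witness.
  Disc-quadratic : ∃[ c₂ ] ∀ t u → Disc (t + u) ≈ Disc t + u * Disc′ t + u ² * c₂ × Disc″ t ≈ 2# * c₂
  Disc-quadratic = _ , taylor _ _ _

  c₂ : Carrier
  c₂ = proj₁ Disc-quadratic

  Disc-taylor : ∀ t u → Disc (t + u) ≈ Disc t + u * Disc′ t + u ² * c₂
  Disc-taylor t u = proj₁ (proj₂ Disc-quadratic t u)

  Disc″≈ : ∀ t → Disc″ t ≈ 2# * c₂
  Disc″≈ t = proj₂ (proj₂ Disc-quadratic t 0#)

  -- Points of the conic over a given value of the map

  form-expansion : ∀ v → let ⟨ X₁ , X₂ , X₀ ⟩ = v in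
    A * X₁ ² + 2# * B * X₁ * X₂ + C * X₂ ² + 2# * D * X₁ * X₀ + 2# * E * X₂ * X₀ + F * X₀ ² ≈ form S (vector v)
  form-expansion v = solve 9 (λ A B C D E F x y z →
    A :* (x :* x) :+ :2 :* B :* x :* y :+ C :* (y :* y) :+ :2 :* D :* x :* z :+ :2 :* E :* y :* z :+ F :* (z :* z) :=
    x :* (A :* x :+ B :* y :+ D :* z) :+ y :* (B :* x :+ C :* y :+ E :* z) :+ z :* (D :* x :+ E :* y :+ F :* z))
    (A ∷ B ∷ C ∷ D ∷ E ∷ F ∷ x₁ v ∷ x₂ v ∷ x₀ v ∷ [])

  line-value : ∀ t v → L t · v ≈ α · v - t * (β · v)
  line-value t ⟨ x , y , z ⟩ = solve 10 (λ a b c d e f t x y z →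
    (a :- d :* t) :* x :+ (b :- e :* t) :* y :+ (c :- f :* t) :* z :=
    a :* x :+ b :* y :+ c :* z :- t :* (d :* x :+ e :* y :+ f :* z))
    (a ∷ b ∷ c ∷ d ∷ e ∷ f ∷ t ∷ x ∷ y ∷ z ∷ [])

  on-line : ∀ {t} P (fin : Finite P) → ℓ P fin ≈ t → L t · vector (coordinates P) ≈ 0#
  on-line {t} P fin e = trans (line-value t v) (modulo (quotient⇒product fin e) {1#}
    (solve 2 (λ x y → x :- y := :0 :+ :1 :* (x :- y)) (α · v ∷ t * (β · v) ∷ [])))
    where v = vector (coordinates P)

  on-line⁻¹ : ∀ {t} P → L t · vector (coordinates P) ≈ 0# → numerator P ≈ t * denominator P
  on-line⁻¹ {t} P e = modulo (trans (sym (line-value t v)) e) {1#}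
    (solve 2 (λ x y → x := y :+ :1 :* (x :- y :- :0)) (α · v ∷ t * (β · v) ∷ []))
    where v = vector (coordinates P)

  -- `L t ⨯ e₃` is `(q , - p , 0)`, whose multiple by `s` gives the terms with the square root; the
  -- others form `- polar`.
  coords≋eigenvector : ∀ t s → vector (coords t s) ≋ eigenvector S (L t) (L t ⨯ e₃) s
  coords≋eigenvector t s =
    ⟨ solve 10 (λ A B C D E F p q r s → let m = M A B C D E F (w₁ p q r) (w₂ p q r) (w₀ p q r) in
        B :* q :* r :- C :* p :* r :- D :* (q :* q) :+ E :* p :* q :+ q :* s :=
        s :* w₁ p q r :- (q :* proj₂ (proj₂ m) :- r :* proj₁ (proj₂ m))) ρ
    , solve 10 (λ A B C D E F p q r s → let m = M A B C D E F (w₁ p q r) (w₂ p q r) (w₀ p q r) in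
        :- (A :* q :* r) :+ B :* p :* r :+ D :* p :* q :- E :* (p :* p) :- p :* s :=
        s :* w₂ p q r :- (r :* proj₁ m :- p :* proj₂ (proj₂ m))) ρ
    , solve 10 (λ A B C D E F p q r s → let m = M A B C D E F (w₁ p q r) (w₂ p q r) (w₀ p q r) in
        A :* (q :* q) :- :2 :* B :* p :* q :+ C :* (p :* p) :=
        s :* w₀ p q r :- (p :* proj₁ (proj₂ m) :- q :* proj₁ m)) ρ ⟩
    where
    ρ = A ∷ B ∷ C ∷ D ∷ E ∷ F ∷ a - d * t ∷ b - e * t ∷ c - f * t ∷ s ∷ []

    w₁ w₂ w₀ : Polynomial 10 → Polynomial 10 → Polynomial 10 → Polynomial 10
    w₁ p q r = q :* :1 :- r :* :0
    w₂ p q r = r :* :0 :- p :* :1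
    w₀ p q r = p :* :0 :- q :* :0

    M : (A B C D E F x y z : Polynomial 10) → Polynomial 10 × Polynomial 10 × Polynomial 10
    M A B C D E F x y z = A :* x :+ B :* y :+ D :* z , B :* x :+ C :* y :+ E :* z , D :* x :+ E :* y :+ F :* z

  nonzero⇒apart : ∀ {v} → NonZero v → Apart (vector v)
  nonzero⇒apart (inj₁ x₁#0) = apart₁ x₁#0
  nonzero⇒apart (inj₂ (inj₁ x₂#0)) = apart₂ x₂#0
  nonzero⇒apart (inj₂ (inj₂ x₀#0)) = apart₀ x₀#0

  apart⇒nonzero : ∀ {v} → Apart (vector v) → NonZero v
  apart⇒nonzero {v} v#𝟎 with zero⊎nonzero (x₁ v) | zero⊎nonzero (x₂ v) | zero⊎nonzero (x₀ v)
  ... | inj₂ x₁#0 | _ | _ = inj₁ x₁#0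
  ... | inj₁ _ | inj₂ x₂#0 | _ = inj₂ (inj₁ x₂#0)
  ... | inj₁ _ | inj₁ _ | inj₂ x₀#0 = inj₂ (inj₂ x₀#0)
  ... | inj₁ x₁≈0 | inj₁ x₂≈0 | inj₁ x₀≈0 = contradiction ⟨ x₁≈0 , x₂≈0 , x₀≈0 ⟩ (apart⇒¬zero v#𝟎)

  coords-on-line : ∀ t s → L t · vector (coords t s) ≈ 0#
  coords-on-line t s = trans (·-congˡ (L t) (coords≋eigenvector t s)) (eigenvector-on-line S s (·-⨯ (L t) e₃))

  coords-on-conic : ∀ {t s} (nz : NonZero (coords t s)) → s ² ≈ Disc t → OnConic (point (coords t s) nz)
  coords-on-conic {t} {s} nz s² = trans (form-expansion (coords t s))
    (trans (form-cong S (coords≋eigenvector t s)) (eigenvector-on-conic S (trans s² (Disc≈disc t)) (·-⨯ (L t) e₃)))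

  module _ {t s} (nz : NonZero (coords t s)) (defined : Defined (point (coords t s) nz)) where

    private
      P = point (coords t s) nz

    -- On `L t` the numerator is `t` times the denominator, so the two can only vanish together.
    coords-finite : Finite P
    coords-finite =
      [ (λ num#0 → nonzeroʳ {t} (#-congʳ (on-line⁻¹ P (coords-on-line t s)) num#0)) , (λ den#0 → den#0) ]′ defined

    ℓ-coords : ℓ P coords-finite ≈ t
    ℓ-coords = product⇒quotient coords-finite (on-line⁻¹ P (coords-on-line t s))

  constant-progression : ∀ {n} P → OnConic P → Finite P → IsArithmeticProgression {n} (λ _ → P)
  constant-progression P onConic fin = 0# , record
    { onConic = λ _ → onConic ; finite = λ _ → fin ; step = λ _ _ _ → -‿inverseʳ _ }

  on-line⇒square : ∀ {t} P → OnConic P → L t · vector (coordinates P) ≈ 0# →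
    ∃[ μ ] polar S (L t) (vector (coordinates P)) ≋ μ ⊙ vector (coordinates P) × μ ² ≈ Disc t
  on-line⇒square {t} P@(point v nz) onConic L·v≈0 =
    let μ , Tv , μ² = eigenvalue S (nonzero⇒apart nz) L·v≈0 (trans (sym (form-expansion v)) onConic)
    in μ , Tv , trans μ² (sym (Disc≈disc t))

  -- The factor of proportionality is nonzero, since otherwise `v` would vanish.
  ∼-from-⨯ : ∀ {v w} → NonZero v → NonZero w → vector w ⨯ vector v ≋ 𝟎 → v ∼ w
  ∼-from-⨯ {v} {w} v≠0 w≠0 w⨯v≋𝟎 = μ , nonzero-unless μ≉0 , ≈₁ , ≈₂ , ≈₀
    where
    multiple : ∃[ μ ] vector v ≋ μ ⊙ vector w
    multiple = parallel (nonzero⇒apart w≠0) w⨯v≋𝟎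

    μ = proj₁ multiple

    open _≋_ (proj₂ multiple)

    μ≉0 : ¬ μ ≈ 0#
    μ≉0 μ≈0 = apart⇒¬zero (nonzero⇒apart v≠0) ⟨ vanish ≈₁ , vanish ≈₂ , vanish ≈₀ ⟩
      where
      vanish : ∀ {x y} → x ≈ μ * y → x ≈ 0#
      vanish {y = y} e = trans e (trans (*-congʳ μ≈0) (zeroˡ y))

  -- Let `μ` be the eigenvalue at `P`. If `x₀(t)` is nonzero, the root is `- μ`, because
  -- `coords t s` belongs to the eigenvalue `- s`. If `P` has third coordinate zero, the given root
  -- works.
  determined⇒form : ∀ {t} P → OnConic P → L t · vector (coordinates P) ≈ 0# → Determined P t → HasForm P t
  determined⇒form {t} P@(point v nz) onConic L·v≈0 determined =
    let μ , Tv , μ² = on-line⇒square P onConic L·v≈0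
        has : ∀ s → s ² ≈ Disc t → NonZero (coords t s) → (s + μ) * (e₃ · vector v) ≈ 0# → HasForm P t
        has s s² w≠0 e = s , s² , ∼-from-⨯ nz w≠0 (≋-trans (⨯-anticommutative _ _)
          (≋-trans (⊙-cong refl (≋-trans (⨯-congˡ (vector v) (coords≋eigenvector t s))
                                          (⨯-eigenvector-zero S e₃ L·v≈0 Tv e)))
            ⟨ zeroʳ _ , zeroʳ _ , zeroʳ _ ⟩))
    in [ (λ x₀#0 → has (- μ) (trans (square-neg μ) μ²) (inj₂ (inj₂ x₀#0)) (trans (*-congʳ (-‿inverseˡ μ)) (zeroˡ _)))
       , (λ (v₀≈0 , s , s² , w≠0) → has s s² w≠0 (trans (*-congˡ (trans (e₃· (vector v)) v₀≈0)) (zeroʳ _))) ]′ determined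

  -- Sequences and progressions starting from `t₀`

  module _ (t₀ : Carrier) (Disc′#0 : Disc′ t₀ # 0#) where

    -- For a quadratic polynomial the central difference with step `1` is exactly twice the
    -- derivative, and `L (t₀ ± 1) = L t₀ ∓ β`.
    transversal : L t₀ · matrix (-adjugate S) β # 0#
    transversal = nonzero-unless λ e → zero⇒¬nonzero (cancel-zero 2#0 (2Disc′ e)) Disc′#0
      where
      shift⁺ : L (t₀ + 1#) ≋ L t₀ ⊟ β
      shift⁺ = ⟨ shift a d , shift b e , shift c f ⟩
        where
        shift : ∀ a d → a - d * (t₀ + 1#) ≈ a - d * t₀ - d
        shift a d = solve 3 (λ a d t → a :- d :* (t :+ :1) := a :- d :* t :- d) (a ∷ d ∷ t₀ ∷ [])

      shift⁻ : L (t₀ + - 1#) ≋ L t₀ ⊞ β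
      shift⁻ = ⟨ shift a d , shift b e , shift c f ⟩
        where
        shift : ∀ a d → a - d * (t₀ + - 1#) ≈ a - d * t₀ + d
        shift a d = solve 3 (λ a d t → a :- d :* (t :+ :- :1) := a :- d :* t :+ d) (a ∷ d ∷ t₀ ∷ [])

      Disc⁺ : Disc (t₀ + 1#) ≈ disc S (L t₀ ⊟ β)
      Disc⁺ = trans (Disc≈disc _) (form-cong (-adjugate S) shift⁺)

      Disc⁻ : Disc (t₀ + - 1#) ≈ disc S (L t₀ ⊞ β)
      Disc⁻ = trans (Disc≈disc _) (form-cong (-adjugate S) shift⁻)

      2Disc′ : L t₀ · matrix (-adjugate S) β ≈ 0# → 2# * Disc′ t₀ ≈ 0#
      2Disc′ e = begin
        2# * Disc′ t₀
          ≈⟨ solve 3 (λ q₀ q₁ q₂ → :2 :* q₁ := (q₀ :+ :1 :* q₁ :+ :1 :* :1 :* q₂)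
               :- (q₀ :+ (:- :1) :* q₁ :+ (:- :1) :* (:- :1) :* q₂))
            (Disc t₀ ∷ Disc′ t₀ ∷ c₂ ∷ []) ⟩
        (Disc t₀ + 1# * Disc′ t₀ + 1# ² * c₂) - (Disc t₀ + - 1# * Disc′ t₀ + (- 1#) ² * c₂)
          ≈⟨ +-cong (trans (sym Disc⁺) (Disc-taylor t₀ 1#)) (-‿cong (trans (sym Disc⁻) (Disc-taylor t₀ (- 1#)))) ⟨
        disc S (L t₀ ⊟ β) - disc S (L t₀ ⊞ β)    ≈⟨ disc-sub S (L t₀) β ⟩
        - (2# * 2# * (L t₀ · matrix (-adjugate S) β))    ≈⟨ -‿cong (trans (*-congˡ e) (zeroʳ _)) ⟩
        - 0#    ≈⟨ -0#≈0# ⟩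
        0#    ∎

    -- One point of the conic with finite `ℓ`, taken three times, has common difference `0`.
    progression-exists : IsSquare (Disc t₀) → Σ[ P ∈ (Fin 3 → ℙ²) ] IsArithmeticProgression P
    progression-exists (s , s²) = through (finite-point S {L t₀} {β} transversal (trans s² (Disc≈disc t₀)))
      where
      through : ∃[ v ] form S v ≈ 0# × β · v # 0# → Σ[ P ∈ (Fin 3 → ℙ²) ] IsArithmeticProgression P
      through (⟨ x , y , z ⟩ , Q≈0 , β·v#0) =
        _ , constant-progression (point v (apart⇒nonzero (β , β·v#0))) (trans (form-expansion v) Q≈0) β·v#0
        where
        v : Coordinates
        v = ⟨ x , y , z ⟩

    -- The sequence is `t₀, t₀ + u, t₀ + u, …` for one further parameter `t₀ + u` from
    -- `another-square`.
    nonconstant-squares : IsSquare (Disc t₀) → ∀ n → 2 ≤ n →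
                          Σ[ t ∈ (Fin n → Carrier) ] NonConstant t × (∀ i → IsSquare (Disc (t i)))
    nonconstant-squares (s , s²) (ℕ.suc (ℕ.suc n)) (s≤s (s≤s _)) = sequence (another-square {q₂ = c₂} s² Disc′#0)
      where
      sequence : ∃[ u ] u # 0# × IsSquare (Disc t₀ + u * Disc′ t₀ + u ² * c₂) →
                 Σ[ t ∈ (Fin (2 ℕ.+ n) → Carrier) ] NonConstant t × (∀ i → IsSquare (Disc (t i)))
      sequence (u , u#0 , r , r²) = t , (suc zero , zero , t₀+u#t₀) , square
        where
        t : Fin (2 ℕ.+ n) → Carrier
        t zero = t₀
        t (suc _) = t₀ + u

        square : ∀ i → IsSquare (Disc (t i))
        square zero = s , s²
        square (suc _) = r , trans r² (sym (Disc-taylor t₀ u))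

        t₀+u#t₀ : t₀ + u # t₀
        t₀+u#t₀ = invertible⇒# (u#0 ⁻¹ , trans (*-comm _ _) (inverse) , inverse)
          where
          inverse : (t₀ + u - t₀) * u#0 ⁻¹ ≈ 1#
          inverse = trans (solve 3 (λ t u i → (t :+ u :- t) :* i := u :* i)
            (t₀ ∷ u ∷ u#0 ⁻¹ ∷ [])) (inverseʳ u#0)

    threeTerms-values : ∀ {P : Fin 3 → ℙ²} {δ} (ap : IsProgression P δ) (let open IsProgression ap) →
                        ℓ (P (suc zero)) (finite (suc zero)) ≈ t₀ → ∀ i → ℓ (P i) (finite i) ≈ threeTerms t₀ δ i
    threeTerms-values {P} {δ} ap e = value
      where
      open IsProgression ap

      value : ∀ i → ℓ (P i) (finite i) ≈ threeTerms t₀ δ i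
      value zero = modulo e {1#} (modulo (step zero (suc zero) ≡.refl) { - 1# }
        (solve 4 (λ x y t δ → x := t :- δ :+ :1 :* (y :- t) :+ (:- :1) :* (y :- x :- δ))
          (ℓ (P zero) (finite zero) ∷ ℓ (P (suc zero)) (finite (suc zero)) ∷ t₀ ∷ δ ∷ [])))
      value (suc zero) = e
      value (suc (suc zero)) = modulo e {1#} (modulo (step (suc zero) (suc (suc zero)) ≡.refl) {1#}
        (solve 4 (λ x y t δ → x := t :+ δ :+ :1 :* (y :- t) :+ :1 :* (x :- y :- δ))
          (ℓ (P (suc (suc zero))) (finite (suc (suc zero))) ∷ ℓ (P (suc zero)) (finite (suc zero)) ∷ t₀ ∷ δ ∷ [])))

    -- The common difference in terms of the cubic

    module _ (δ : Carrier) where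

      private
        q₀ = Disc t₀
        q₁ = Disc′ t₀
        k = invariant t₀ Disc′#0

      -- The right-hand side is the discriminant of `q₀ + u q₁ + u² c₂` as a quadratic in `u`.
      kq₁² : k * q₁ ² ≈ q₁ ² - 4# * (q₀ * c₂)
      kq₁² = begin
        k * q₁ ²                             ≈⟨ quotient⇒product (x#0y#0→xy#0 Disc′#0 Disc′#0) refl ⟨
        q₁ ² - 2# * q₀ * Disc″ t₀            ≈⟨ +-congˡ (-‿cong (*-congˡ (Disc″≈ t₀))) ⟩
        q₁ ² - 2# * q₀ * (2# * c₂)
          ≈⟨ solve 3 (λ q₀ q₁ q₂ → q₁ :* q₁ :- :2 :* q₀ :* (:2 :* q₂) := q₁ :* q₁ :- :4 :* (q₀ :* q₂))
            (q₀ ∷ q₁ ∷ c₂ ∷ []) ⟩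
        q₁ ² - 4# * (q₀ * c₂)                ∎

      -- On `X = 0` the cubic becomes `Y² + 4kY = 0`. Its root `- 4k`, unlike `0`, leaves the
      -- denominator `Y²` nonzero.
      zero-from-cubic : k # 0# → δ ≈ 0# → FromCubic t₀ Disc′#0 δ
      zero-from-cubic k#0 δ≈0 = 0# , - (4# * k) ,
        solve 1 (λ k → let Y = :- (:4 :* k) in
          Y :* Y :+ :4 :* :0 :* Y :+ :4 :* k :* Y := :0 :* (:0 :* :0) :+ k :* (:0 :* :0))
          (k ∷ []) ,
        den#0 ,
        trans δ≈0 (solve 3 (λ x Y i → :0 := :- x :* (:4 :* :0 :* Y :* i))
          (q₀ / q₁ ⟨ Disc′#0 ⟩ ∷ - (4# * k) ∷ den#0 ⁻¹ ∷ []))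
        where
        den#0 : (- (4# * k)) ² + 2# * 0# * - (4# * k) + k * 0# ² # 0#
        den#0 = #-congʳ (solve 1 (λ k → let Y = :- (:4 :* k) in
          (:4 :* k) :* (:4 :* k) := Y :* Y :+ :2 :* :0 :* Y :+ k :* (:0 :* :0))
          (k ∷ []))
          (x#0y#0→xy#0 (x#0y#0→xy#0 4#0 k#0) (x#0y#0→xy#0 4#0 k#0))

      module _ {s r₁ r₃} (q₀#0 : q₀ # 0#) (δ#0 : δ # 0#)
               (s² : s ² ≈ q₀) (r₁² : r₁ ² ≈ Disc (t₀ - δ)) (r₃² : r₃ ² ≈ Disc (t₀ + δ)) where

        s#0 : s # 0#
        s#0 = nonzeroˡ (#-congʳ (sym s²) q₀#0)

        private
          -- Dividing by the root `s` makes `2 r i` a root of the normalised square; `i²` stands for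
          -- `1 / q₀`.
          i = s#0 ⁻¹
          τ = δ * q₁ * i ²

        q₀i² : q₀ * i ² ≈ 1#
        q₀i² = modulo s² { - (i ²)} (modulo (inverseʳ s#0) {s * i + 1#}
          (solve 3 (λ q s i → q :* (i :* i) := :1 :+ (:- (i :* i)) :* (s :* s :- q) :+ (s :* i :+ :1) :* (s :* i :- :1))
            (q₀ ∷ s ∷ i ∷ [])))

        -- 4 Disc (t₀ + u) / Disc t₀ in terms of the normalised difference u q₁ / q₀.
        normalise-square : ∀ {r} u → r ² ≈ Disc (t₀ + u) →
                           (2# * r * i) ² ≈ (2# + u * q₁ * i ²) ² - k * (u * q₁ * i ²) ²
        normalise-square {r} u r² = modulo (trans r² (Disc-taylor t₀ u)) {4# * i ²}
          (modulo q₀i² {4# - 4# * (i ² * u ² * c₂)} (modulo kq₁² {u ² * (i ²) ²}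
          (solve 7 (λ q₀ q₁ q₂ k r u i → let J = i :* i ; σ = u :* q₁ :* J in
            (:2 :* r :* i) :* (:2 :* r :* i) :=
            (:2 :+ σ) :* (:2 :+ σ) :- k :* (σ :* σ)
              :+ (:4 :* J) :* (r :* r :- (q₀ :+ u :* q₁ :+ u :* u :* q₂))
              :+ (:4 :- :4 :* (J :* (u :* u) :* q₂)) :* (q₀ :* J :- :1)
              :+ (u :* u :* (J :* J)) :* (k :* (q₁ :* q₁) :- (q₁ :* q₁ :- :4 :* (q₀ :* q₂))))
            (q₀ ∷ q₁ ∷ c₂ ∷ k ∷ r ∷ u ∷ i ∷ []))))

        normalise-square⁻ : (2# * r₁ * i) ² ≈ (2# - τ) ² - k * τ ²
        normalise-square⁻ = trans (normalise-square (- δ) r₁²)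
          (solve 4 (λ k δ q₁ J → let τ = δ :* q₁ :* J ; σ = (:- δ) :* q₁ :* J in
            (:2 :+ σ) :* (:2 :+ σ) :- k :* (σ :* σ) := (:2 :- τ) :* (:2 :- τ) :- k :* (τ :* τ))
              (k ∷ δ ∷ q₁ ∷ i ² ∷ []))

        -- This carries the degenerate case of `cubic-point` back to the vanishing of a
        -- discriminant.
        root-zero : ∀ {r x} → r ² ≈ x → 2# * r * i ≈ 0# → x ≈ 0#
        root-zero {r} r² e = trans (sym r²) (trans (*-congʳ r≈0) (zeroˡ r))
          where
          i#0 : i # 0#
          i#0 = nonzeroʳ {s} (#-congʳ (sym (inverseʳ s#0)) 1#0)

          r≈0 : r ≈ 0#
          r≈0 = cancel-zero 2#0 (cancel-zero i#0 (trans (*-comm i (2# * r)) e))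

        -- In `cubic-point`, `y` comes from the root at `t₀ + δ` and `z` from the one at `t₀ - δ`.
        nonzero-from-cubic : ¬ (k ≈ 0# × (Disc (t₀ - δ) ≈ 0# ⊎ Disc (t₀ + δ) ≈ 0#)) → FromCubic t₀ Disc′#0 δ
        nonzero-from-cubic ¬degenerate = conclude (cubic-point
          (x#0y#0→xy#0 (x#0y#0→xy#0 δ#0 Disc′#0) (nonzeroʳ {q₀} (#-congʳ (sym q₀i²) 1#0)))
          (normalise-square δ r₃²) normalise-square⁻
          (λ (k≈0 , e) → ¬degenerate (k≈0 ,
            [ (λ y≈0 → inj₂ (root-zero r₃² y≈0)) , (λ z≈0 → inj₁ (root-zero r₁² z≈0)) ]′ e)))
          where
          conclude : ∃[ X ] ∃[ Y ] OnCubic k X Y × (Y ² + 2# * X * Y + k * X ² # 0#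
                       × τ * (Y ² + 2# * X * Y + k * X ²) ≈ - (4# * X * Y)) → FromCubic t₀ Disc′#0 δ
          -- `δ = τ q₀ / q₁` undoes the normalisation, and `τ` is then `- 4XY` over the denominator.
          conclude (X , Y , onCubic , den#0 , τden) = X , Y , onCubic , den#0 ,
            modulo τden {q₀ * j * m} (modulo (inverseʳ den#0) { - (q₀ * j * τ)}
            (modulo (inverseʳ Disc′#0) { - (δ * (q₀ * i ²))} (modulo q₀i² { - δ }
            (solve 8 (λ q₀ q₁ δ J W den m j → let τ = δ :* q₁ :* J in
              δ := :- (q₀ :* j) :* (W :* m)
                :+ (q₀ :* j :* m) :* (τ :* den :- :- W)
                :+ (:- (q₀ :* j :* τ)) :* (den :* m :- :1)
                :+ (:- (δ :* (q₀ :* J))) :* (q₁ :* j :- :1)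
                :+ (:- δ) :* (q₀ :* J :- :1))
              (q₀ ∷ q₁ ∷ δ ∷ i ² ∷ 4# * X * Y ∷ Y ² + 2# * X * Y + k * X ² ∷ m ∷ j ∷ [])))))
            where
            m = den#0 ⁻¹
            j = Disc′#0 ⁻¹

      -- The case distinction follows the clauses of `Exceptional`: `δ = 0` with `k = 0`,
      -- `Disc t₀ = 0` with `δ` nonzero, and `k = 0` with an outer discriminant zero.
      from-cubic : (∀ i → IsSquare (Disc (threeTerms t₀ δ i))) → ¬ Exceptional t₀ Disc′#0 δ → FromCubic t₀ Disc′#0 δ
      from-cubic squares ¬exceptional =
        [ (λ δ≈0 → [ (λ k≈0 → contradiction (inj₂ (k≈0 , inj₁ δ≈0)) ¬exceptional)
                   , (λ k#0 → zero-from-cubic k#0 δ≈0) ]′ (zero⊎nonzero k))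
        , (λ δ#0 → [ (λ q₀≈0 → contradiction (inj₁ (q₀≈0 , δ#0)) ¬exceptional)
                   , (λ q₀#0 → nonzero-from-cubic q₀#0 δ#0
                       (proj₂ (squares (suc zero))) (proj₂ (squares zero)) (proj₂ (squares (suc (suc zero))))
                       (λ (k≈0 , e) → ¬exceptional (inj₂ (k≈0 , inj₂ e)))) ]′ (zero⊎nonzero q₀)) ]′ (zero⊎nonzero δ)

theorem5 : ∀ {p ℓ₁ ℓ₂} (K : HeytingField p ℓ₁ ℓ₂) → let open OverField K in
    Decidable _#_ →
    2# # 0# →
    (𝒞 : Conic) (ℒ : LinearMap) → let open ConicWithMap 𝒞 ℒ in
    (t₀ : Carrier) → IsSquare (Disc t₀) →
    (Disc′t₀#0 : Disc′ t₀ # 0#) →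
    (∀ (n : ℕ) → 2 ≤ n →
    (Σ[ t ∈ (Fin n → Carrier) ] NonConstant t × (∀ i → IsSquare (Disc (t i))))
    × (∀ (t s : Fin n → Carrier) → (∀ i → s i ² ≈ Disc (t i)) →
    (nz : ∀ i → NonZero (coords (t i) (s i))) →
    let P = λ (i : Fin n) → point (coords (t i) (s i)) (nz i) in
    (∀ i → OnConic (P i))
    × ((∀ i → Defined (P i)) →
    Σ[ fin ∈ (∀ i → Finite (P i)) ]
    (∀ i j → toℕ j ≡ ℕ.suc (toℕ i) →
    ℓ (P j) (fin j) - ℓ (P i) (fin i) ≈ t j - t i))))
    × (Σ[ P ∈ (Fin 3 → ℙ²) ] IsArithmeticProgression P)
    × (∀ (P : Fin 3 → ℙ²) (δ : Carrier) (ap : IsProgression P δ) →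
    ℓ (P (suc zero)) (IsProgression.finite ap (suc zero)) ≈ t₀ →
    (∀ i → IsSquare (Disc (threeTerms t₀ δ i))
    × (Determined (P i) (threeTerms t₀ δ i) → HasForm (P i) (threeTerms t₀ δ i)))
    × (¬ Exceptional t₀ Disc′t₀#0 δ → FromCubic t₀ Disc′t₀#0 δ))
theorem5 K _#?_ 2#0 𝒞 ℒ t₀ square Disc′#0 =
  (λ n 2≤n → nonconstant-squares t₀ Disc′#0 square n 2≤n , λ t s s² nz →
    (λ i → coords-on-conic (nz i) (s² i)) ,
    λ defined → (λ i → coords-finite (nz i) (defined i)) ,
      λ i j _ → +-cong (ℓ-coords (nz j) (defined j)) (-‿cong (ℓ-coords (nz i) (defined i)))) ,
  progression-exists t₀ Disc′#0 square ,
  λ P δ ap e →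
    let open IsProgression ap
        t = threeTerms t₀ δ
        line = λ i → on-line (P i) (finite i) (threeTerms-values t₀ Disc′#0 ap e i)
        -- The square root is the eigenvalue of the polar map at `P i`.
        squares = λ i → let c , _ , c² = on-line⇒square {t i} (P i) (onConic i) (line i) in c , c²
    in (λ i → squares i , determined⇒form (P i) (onConic i) (line i)) , from-cubic t₀ Disc′#0 δ squares
  where
  open OverField K
  open ConicWithMap 𝒞 ℒ
  open Progressions K _#?_ 2#0 𝒞 ℒ
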